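{- There is an absolute constant $C>0$ such that for every integer $n\ge 73$, $$\left| f\left(n, \left\lfloor \tfrac{n^2}{4}\right\rfloor+1\right) - \frac{2n^2}{33}\right| \le C n,$$ i.e. $f(n, \lfloor n^2/4\rfloor+1)=\frac{2n^2}{33}+O(n)$.
   Context: All graphs are finite and simple. For a graph $G$, $\overline{G}$ denotes its complement. Let $G$ be a $K_4$-free graph. An edge of $\overline{G}$ (i.e. a pair of non-adjacent vertices of $G$) is called a $K_4$-saturating edge if adding it to $G$ creates a copy of $K_4$. Let $f(G)$ denote the number of $K_4$-saturating edges of $G$. For integers $n,e$, let $f(n,e)$ denote the largest integer $\ell$ such that every $n$-vertex $K_4$-free graph with exactly $e$ edges has at least $\ell$ $K_4$-saturating edges. -}

module Defs where

open import Data.Nat using (ℕ; suc; _<_; _≤_; _<ᵇ_)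
open import Data.Bool using (Bool; true; false; _∧_; not; T)
open import Data.Fin using (Fin; toℕ)
open import Data.List using (List; length; filter; concatMap; map)
open import Data.Bool.ListAction using (any)
open import Data.List.Base using (allFin)
open import Data.Product using (_×_; _,_; proj₁; proj₂)
open import Data.Empty using (⊥)
open import Relation.Nullary using (¬_)
open import Relation.Binary.PropositionalEquality using (_≡_)
open import Relation.Nullary.Decidable using (Dec)
open import Data.Bool.Properties using (T?)

record Graph (n : ℕ) : Set where
  field
    adj    : Fin n → Fin n → Bool
    sym    : ∀ i j → adj i j ≡ adj j i
    irrefl : ∀ i → adj i i ≡ false
open Graph public

pairs : (n : ℕ) → List (Fin n × Fin n)
pairs n = filter (λ p → T? (toℕ (proj₁ p) <ᵇ toℕ (proj₂ p)))
                 (concatMap (λ i → map (λ j → (i , j)) (allFin n)) (allFin n))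

edges : ∀ {n} → Graph n → ℕ
edges {n} G = length (filter (λ p → T? (adj G (proj₁ p) (proj₂ p))) (pairs n))

-- G is K4-free: no four vertices that are pairwise adjacent
-- (pairwise adjacency forces them distinct, by irreflexivity).
K4Free : ∀ {n} → Graph n → Set
K4Free {n} G = (a b c d : Fin n) →
  T (adj G a b) → T (adj G a c) → T (adj G a d) →
  T (adj G b c) → T (adj G b d) → T (adj G c d) → ⊥

-- The non-edge uv is K4-saturating: adding uv creates a K4, i.e. there are
-- w, x with u,v,w,x pairwise adjacent apart from the pair uv.
saturating : ∀ {n} → Graph n → Fin n → Fin n → Bool
saturating {n} G u v =
  not (adj G u v) ∧
  any (λ w → any (λ x →
        adj G u w ∧ adj G u x ∧ adj G v w ∧ adj G v x ∧ adj G w x)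
      (allFin n)) (allFin n)

satCount : ∀ {n} → Graph n → ℕ
satCount {n} G =
  length (filter (λ p → T? (saturating G (proj₁ p) (proj₂ p))) (pairs n))

LowerBound : ℕ → ℕ → ℕ → Set
LowerBound n e ℓ = (G : Graph n) → K4Free G → edges G ≡ e → ℓ ≤ satCount G

IsF : ℕ → ℕ → ℕ → Set
IsF n e ℓ = LowerBound n e ℓ × ¬ LowerBound n e (suc ℓ)

{-# OPTIONS --safe #-}
module Submission where

-- Lower bound.  Take vertex-disjoint triangles T₁ … Tₖ that cannot be enlarged by adding a
-- triangle of the rest R, nor by exchanging a vertex of some Tᵢ for one of R and then adding a
-- triangle.  A vertex outside Tᵢ adjacent to two of its vertices saturates with the third,
-- which accounts for the saturating pairs meeting the Tᵢ; the best Tᵢ = xyz has many vertices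
-- of R adjacent to two of x, y, z, and each of the three classes xy, xz, yz consists of
-- pairwise saturating vertices.  If one class is empty, convexity finishes.  If none is, the
-- exchange property makes N(x) ∩ R, N(y) ∩ R and N(z) ∩ R independent, and Mantel's theorem
-- after deleting one class, or the other two, shows that R misses enough edges to make up for
-- the three-way splitting.
-- Upper bound.  A balanced complete bipartite graph on n − c vertices together with an
-- independent set C of c ≈ 2n/33 vertices joined to about half of each side.

open import Defs hiding (sym)
open import Data.Bool using (Bool; true; false; _∧_; _∨_; not; T; if_then_else_; _xor_)
open import Data.Bool.ListAction using (any; or)
open import Data.Bool.Properties using (T?; T-∧; T-∨; ∧-comm; ∨-comm; ∨-identityʳ; xor-comm; xor-same)
open import Data.Empty using (⊥; ⊥-elim)
open import Data.Fin using (Fin; zero; suc; toℕ)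
open import Data.Fin.Patterns using (0F; 1F; 2F)
open import Data.Fin.Properties using (_≟_; any?; all?; toℕ-injective; toℕ<n)
open import Data.List using (List; []; _∷_; _++_; length; map; filter; concatMap; allFin)
open import Data.List.Membership.Propositional using (_∈_; lose; find)
open import Data.List.Membership.Propositional.Properties using (∈-allFin)
open import Data.List.Properties using (length-tabulate; map-cong)
open import Data.List.Relation.Unary.Any as Any using (here; there)
open import Data.List.Relation.Unary.Any.Properties using (any⁺; any⁻)
open import Data.Nat using (ℕ; zero; suc; _+_; _*_; _∸_; _≤_; _<_; z≤n; s≤s; _≡ᵇ_; _≤ᵇ_; _<ᵇ_; >-nonZero)
open import Data.Nat.DivMod using (_/_; _%_; m≡m%n+[m/n]*n; m%n<n; m/n*n≤m)
open import Data.Nat.Properties hiding (_≟_)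
import Data.Nat.Properties as ℕₚ
open import Data.Nat.Tactic.RingSolver using (solve-∀)
open import Data.Product using (∃; _×_; _,_; proj₁; proj₂)
open import Data.Sum using (_⊎_; inj₁; inj₂; [_,_]′)
open import Data.Unit using (tt)
open import Data.Vec using (Vec; []; _∷_; lookup; tabulate)
open import Data.Vec.Properties using (lookup∘tabulate)
open import Function using (_∘_; id; Equivalence)
open import Relation.Binary.Definitions using (tri<; tri≈; tri>)
open import Relation.Binary.PropositionalEquality
open import Relation.Nullary using (¬_; Dec; yes; no; does)
open import Relation.Nullary.Decidable using (¬?; _→-dec_; _×-dec_; _⊎-dec_; map′; toWitness; dec-false)
open import Relation.Unary using (Pred; Decidable)

-- Finite sums

-- Write m = |R|, k for the number of triangles, f for m² minus twice the arcs in R (the defect in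
-- Mantel's theorem), Q for the sum of the squares of the three classes and W for the number of
-- ordered saturating pairs. More than n²/4 edges force 2W ≥ 2Q + f + 2km + 3k², and the best
-- triangle gives 2Q + f ≥ (2m - 3k)²/16 when 2m ≥ 3k. Since n = m + 3k, this makes W/2 at least
-- n²/16 - nk/16 + 33k²/64. The construction has c²/2 + (2n - c)²/64 saturating pairs up to O(n),
-- which is the same quadratic with c in place of k; its minimum, 2n²/33, is at c = 2n/33. The
-- defect f is carried through the estimates because three classes of total size S only give Q ≥
-- S²/3, where two give S²/2.

⟦_⟧ : Bool → ℕ
⟦ b ⟧ = if b then 1 else 0

⟦⟧≤1 : ∀ b → ⟦ b ⟧ ≤ 1
⟦⟧≤1 true  = ≤-refl
⟦⟧≤1 false = z≤n

⟦⟧-bound : ∀ b {k} → (T b → 1 ≤ k) → ⟦ b ⟧ ≤ k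
⟦⟧-bound true  h = h tt
⟦⟧-bound false h = z≤n

T⇒⟦⟧≡1 : ∀ {b} → T b → ⟦ b ⟧ ≡ 1
T⇒⟦⟧≡1 {true} _ = refl

⟦⟧-∧ : ∀ b c → ⟦ b ∧ c ⟧ ≡ ⟦ b ⟧ * ⟦ c ⟧
⟦⟧-∧ true  c = sym (*-identityˡ ⟦ c ⟧)
⟦⟧-∧ false c = refl

module _ {a} {A : Set a} where

  Σ : List A → (A → ℕ) → ℕ
  Σ []       f = 0
  Σ (x ∷ xs) f = f x + Σ xs f

  Σ-cong : ∀ xs {f g : A → ℕ} → (∀ x → f x ≡ g x) → Σ xs f ≡ Σ xs g
  Σ-cong []       h = refl
  Σ-cong (x ∷ xs) h = cong₂ _+_ (h x) (Σ-cong xs h)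

  Σ-mono : ∀ xs {f g : A → ℕ} → (∀ x → f x ≤ g x) → Σ xs f ≤ Σ xs g
  Σ-mono []       h = z≤n
  Σ-mono (x ∷ xs) h = +-mono-≤ (h x) (Σ-mono xs h)

  Σ-const : ∀ xs c → Σ xs (λ _ → c) ≡ length xs * c
  Σ-const []       c = refl
  Σ-const (x ∷ xs) c = cong (c +_) (Σ-const xs c)

  Σ-zero : ∀ xs → Σ xs (λ _ → 0) ≡ 0
  Σ-zero []       = refl
  Σ-zero (x ∷ xs) = Σ-zero xs

  Σ-+ : ∀ xs (f g : A → ℕ) → Σ xs (λ x → f x + g x) ≡ Σ xs f + Σ xs g
  Σ-+ []       f g = refl
  Σ-+ (x ∷ xs) f g rewrite Σ-+ xs f g = lem (f x) (g x) (Σ xs f) (Σ xs g)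
    where lem : ∀ a b c d → a + b + (c + d) ≡ a + c + (b + d)
          lem = solve-∀

  Σ-*ˡ : ∀ c xs (f : A → ℕ) → Σ xs (λ x → c * f x) ≡ c * Σ xs f
  Σ-*ˡ c []       f = sym (*-zeroʳ c)
  Σ-*ˡ c (x ∷ xs) f rewrite Σ-*ˡ c xs f = sym (*-distribˡ-+ c (f x) _)

  Σ-*ʳ : ∀ c xs (f : A → ℕ) → Σ xs (λ x → f x * c) ≡ Σ xs f * c
  Σ-*ʳ c xs f = trans (Σ-cong xs (λ x → *-comm (f x) c)) (trans (Σ-*ˡ c xs f) (*-comm c _))

  Σ-++ : ∀ xs ys (f : A → ℕ) → Σ (xs ++ ys) f ≡ Σ xs f + Σ ys f
  Σ-++ []       ys f = refl
  Σ-++ (x ∷ xs) ys f rewrite Σ-++ xs ys f = sym (+-assoc (f x) _ _)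

  length-filter-Σ : ∀ {p} {P : Pred A p} (P? : Decidable P) xs →
                    length (filter P? xs) ≡ Σ xs (λ x → ⟦ does (P? x) ⟧)
  length-filter-Σ P? []       = refl
  length-filter-Σ P? (x ∷ xs) with does (P? x)
  ... | true  = cong suc (length-filter-Σ P? xs)
  ... | false = length-filter-Σ P? xs

  Σ-filter : ∀ {p} {P : Pred A p} (P? : Decidable P) xs (f : A → ℕ) →
             Σ (filter P? xs) f ≡ Σ xs (λ x → ⟦ does (P? x) ⟧ * f x)
  Σ-filter P? []       f = refl
  Σ-filter P? (x ∷ xs) f with does (P? x)
  ... | true  = cong₂ _+_ (sym (*-identityˡ (f x))) (Σ-filter P? xs f)
  ... | false = Σ-filter P? xs f

module _ {a b} {A : Set a} {B : Set b} where

  Σ-swap : ∀ (xs : List A) (ys : List B) (f : A → B → ℕ) →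
           Σ xs (λ x → Σ ys (f x)) ≡ Σ ys (λ y → Σ xs (λ x → f x y))
  Σ-swap []       ys f = sym (Σ-zero ys)
  Σ-swap (x ∷ xs) ys f rewrite Σ-swap xs ys f = sym (Σ-+ ys (f x) _)

  Σ-map : ∀ (g : A → B) xs (f : B → ℕ) → Σ (map g xs) f ≡ Σ xs (f ∘ g)
  Σ-map g []       f = refl
  Σ-map g (x ∷ xs) f = cong (f (g x) +_) (Σ-map g xs f)

  Σ-concatMap : ∀ (g : A → List B) xs (f : B → ℕ) → Σ (concatMap g xs) f ≡ Σ xs (λ x → Σ (g x) f)
  Σ-concatMap g []       f = refl
  Σ-concatMap g (x ∷ xs) f rewrite sym (Σ-concatMap g xs f) = Σ-++ (g x) (concatMap g xs) f

  ΣΣ-+ : ∀ (xs : List A) (ys : List B) (f g : A → B → ℕ) →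
         Σ xs (λ x → Σ ys (λ y → f x y + g x y)) ≡ Σ xs (λ x → Σ ys (f x)) + Σ xs (λ x → Σ ys (g x))
  ΣΣ-+ xs ys f g = trans (Σ-cong xs (λ x → Σ-+ ys (f x) (g x))) (Σ-+ xs _ _)

  ΣΣ-* : ∀ (xs : List A) (ys : List B) (f : A → ℕ) (g : B → ℕ) →
         Σ xs (λ x → Σ ys (λ y → f x * g y)) ≡ Σ xs f * Σ ys g
  ΣΣ-* xs ys f g = trans (Σ-cong xs (λ x → Σ-*ˡ (f x) ys g)) (Σ-*ʳ (Σ ys g) xs f)

δ : ∀ {n} → Fin n → Fin n → ℕ
δ x v = ⟦ does (v ≟ x) ⟧

∑ : ∀ {n} → (Fin n → ℕ) → ℕ
∑ {n} = Σ (allFin n)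

∑-suc : ∀ {n} (f : Fin (suc n) → ℕ) → ∑ f ≡ f zero + ∑ (f ∘ suc)
∑-suc f = cong (f zero +_) (go _ id)
  where
  go : ∀ n (g : Fin n → _) → Σ (Data.List.tabulate (suc ∘ g)) f ≡ Σ (Data.List.tabulate g) (f ∘ suc)
  go zero    g = refl
  go (suc n) g = cong (f (suc (g zero)) +_) (go n (g ∘ suc))

∑-δ : ∀ {n} (x : Fin n) (f : Fin n → ℕ) → ∑ (λ v → δ x v * f v) ≡ f x
∑-δ {suc n} zero    f = trans (∑-suc (λ v → δ zero v * f v))
  (trans (cong₂ _+_ (+-identityʳ (f zero)) (Σ-zero (allFin n))) (+-identityʳ (f zero)))
∑-δ {suc n} (suc x) f = trans (∑-suc (λ v → δ (suc x) v * f v)) (∑-δ x (f ∘ suc))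

∑-1 : ∀ n → ∑ {n} (λ _ → 1) ≡ n
∑-1 n = trans (Σ-const (allFin n) 1) (trans (*-identityʳ _) (length-tabulate id))

-- Arcs inside a vertex set

2xy≤x²+y² : ∀ x y → 2 * (x * y) ≤ x * x + y * y
2xy≤x²+y² x y with ≤-total x y
... | inj₁ x≤y with t , refl ← m≤n⇒∃[o]m+o≡n x≤y =
  subst (2 * (x * (x + t)) ≤_) (lem x t) (m≤m+n _ (t * t))
  where lem : ∀ x t → 2 * (x * (x + t)) + t * t ≡ x * x + (x + t) * (x + t)
        lem = solve-∀
... | inj₂ y≤x with t , refl ← m≤n⇒∃[o]m+o≡n y≤x =
  subst (2 * ((y + t) * y) ≤_) (lem y t) (m≤m+n _ (t * t))
  where lem : ∀ y t → 2 * ((y + t) * y) + t * t ≡ (y + t) * (y + t) + y * y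
        lem = solve-∀

⟦⟧-*-mono : ∀ b {x y} → (T b → x ≤ y) → ⟦ b ⟧ * x ≤ ⟦ b ⟧ * y
⟦⟧-*-mono true  h = +-monoˡ-≤ 0 (h tt)
⟦⟧-*-mono false h = z≤n

⟦⟧-disjoint : ∀ a b c → (T a → T c) → (T b → T c) → (T a → T b → ⊥) → ⟦ a ⟧ + ⟦ b ⟧ ≤ ⟦ c ⟧
⟦⟧-disjoint false false c     f g h = z≤n
⟦⟧-disjoint true  true  c     f g h = ⊥-elim (h tt tt)
⟦⟧-disjoint true  false true  f g h = ≤-refl
⟦⟧-disjoint true  false false f g h = ⊥-elim (f tt)
⟦⟧-disjoint false true  true  f g h = ≤-refl
⟦⟧-disjoint false true  false f g h = ⊥-elim (g tt)

∧-T : ∀ {x y} → T (x ∧ y) → T x × T y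
∧-T = Equivalence.to T-∧

T-∧⁺ : ∀ {x y} → T x → T y → T (x ∧ y)
T-∧⁺ p q = Equivalence.from T-∧ (p , q)

Mask : ℕ → Set
Mask n = Fin n → Bool

∣_∣ : ∀ {n} → Mask n → ℕ
∣ p ∣ = ∑ (λ v → ⟦ p v ⟧)

module _ {n} (G : Graph n) where

  adj-sym : ∀ {u v} → T (adj G u v) → T (adj G v u)
  adj-sym {u} {v} = subst T (Graph.sym G u v)

  TriangleFree : Mask n → Set
  TriangleFree p = ∀ u v w → T (p u) → T (p v) → T (p w) →
                   T (adj G u v) → T (adj G u w) → T (adj G v w) → ⊥

  edgeIn : Mask n → Fin n → Fin n → Bool
  edgeIn p u v = (p u ∧ p v) ∧ adj G u v

  edgeIn⁻ : ∀ p {u v} → T (edgeIn p u v) → T (p u) × T (p v) × T (adj G u v)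
  edgeIn⁻ p {u} {v} h with q , e ← ∧-T {p u ∧ p v} h with pu , pv ← ∧-T {p u} q = pu , pv , e

  edgeIn⁺ : ∀ p {u v} → T (p u) → T (p v) → T (adj G u v) → T (edgeIn p u v)
  edgeIn⁺ p pu pv e = T-∧⁺ (T-∧⁺ pu pv) e

  edgeIn-sym : ∀ p u v → edgeIn p u v ≡ edgeIn p v u
  edgeIn-sym p u v = cong₂ _∧_ (∧-comm (p u) (p v)) (Graph.sym G u v)

  -- Ordered pairs, so twice the number of edges inside p.
  arcs : Mask n → ℕ
  arcs p = ∑ (λ u → ∑ (λ v → ⟦ edgeIn p u v ⟧))

  -- Adjacent vertices have no common neighbour in p, so their degrees add up to at most c. Summing
  -- this over all arcs bounds the sum of the squared degrees from above, and Cauchy-Schwarz bounds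
  -- it from below.
  mantel : ∀ p → TriangleFree p → 2 * arcs p ≤ ∣ p ∣ * ∣ p ∣
  mantel p tf = cancel c refl
    where
    open ≤-Reasoning
    c = ∣ p ∣
    V = allFin n
    e : Fin n → Fin n → ℕ
    e u v = ⟦ edgeIn p u v ⟧
    d : Fin n → ℕ
    d u = ∑ (e u)

    edge-degrees : ∀ u v → T (edgeIn p u v) → d u + d v ≤ c
    edge-degrees u v h with pu , pv , uv ← edgeIn⁻ p h = begin
      d u + d v                     ≡⟨ Σ-+ V (e u) (e v) ⟨
      ∑ (λ w → e u w + e v w)       ≤⟨ Σ-mono V (λ w → ⟦⟧-disjoint (edgeIn p u w) (edgeIn p v w) (p w)
                                         (proj₁ ∘ proj₂ ∘ edgeIn⁻ p) (proj₁ ∘ proj₂ ∘ edgeIn⁻ p)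
                                         (λ a b → tf u v w pu pv (proj₁ (proj₂ (edgeIn⁻ p a))) uv
                                                    (proj₂ (proj₂ (edgeIn⁻ p a))) (proj₂ (proj₂ (edgeIn⁻ p b))))) ⟩
      c                             ∎

    dd = ∑ (λ u → d u * d u)

    -- Summed over all arcs uv, d(u) + d(v) contributes d(u)² twice for each vertex u.
    degree-squares : 2 * dd ≤ c * arcs p
    degree-squares = begin
      2 * dd
        ≡⟨ cong (dd +_) (+-identityʳ dd) ⟩
      dd + dd
        ≡⟨ cong₂ _+_ (Σ-cong V (λ u → sym (Σ-*ʳ (d u) V (e u))))
             (Σ-cong V (λ v → trans (sym (Σ-*ʳ (d v) V (e v)))
               (Σ-cong V (λ u → cong (λ b → ⟦ b ⟧ * d v) (edgeIn-sym p v u))))) ⟩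
      ∑ (λ u → ∑ (λ v → e u v * d u)) + ∑ (λ v → ∑ (λ u → e u v * d v))
        ≡⟨ cong (∑ (λ u → ∑ (λ v → e u v * d u)) +_) (Σ-swap V V (λ v u → e u v * d v)) ⟩
      ∑ (λ u → ∑ (λ v → e u v * d u)) + ∑ (λ u → ∑ (λ v → e u v * d v))
        ≡⟨ Σ-+ V _ _ ⟨
      ∑ (λ u → ∑ (λ v → e u v * d u) + ∑ (λ v → e u v * d v))
        ≡⟨ Σ-cong V (λ u → trans (sym (Σ-+ V _ _)) (Σ-cong V (λ v → sym (*-distribˡ-+ (e u v) (d u) (d v))))) ⟩
      ∑ (λ u → ∑ (λ v → e u v * (d u + d v)))
        ≤⟨ Σ-mono V (λ u → Σ-mono V (λ v → ⟦⟧-*-mono (edgeIn p u v) (edge-degrees u v))) ⟩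
      ∑ (λ u → ∑ (λ v → e u v * c))
        ≡⟨ Σ-cong V (λ u → Σ-*ʳ c V (e u)) ⟩
      ∑ (λ u → d u * c)
        ≡⟨ Σ-*ʳ c V d ⟩
      arcs p * c
        ≡⟨ *-comm (arcs p) c ⟩
      c * arcs p ∎

    -- Cauchy-Schwarz in tangent form: (2d - c)² ≥ 0, sharp at the extremal degree c/2. Vertices
    -- outside p have degree 0 and are charged nothing.
    tangent : ∀ u → 4 * c * d u ≤ 4 * (d u * d u) + (c * c) * ⟦ p u ⟧
    tangent u with p u
    ... | true  = begin
      4 * c * D                    ≡⟨ lem c D ⟩
      2 * ((2 * D) * c)            ≤⟨ 2xy≤x²+y² (2 * D) c ⟩
      (2 * D) * (2 * D) + c * c    ≡⟨ lem₂ c D ⟩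
      4 * (D * D) + c * c * 1 ∎
      where
      D = ∑ (λ v → ⟦ p v ∧ adj G u v ⟧)
      lem : ∀ c D → 4 * c * D ≡ 2 * ((2 * D) * c)
      lem = solve-∀
      lem₂ : ∀ c D → (2 * D) * (2 * D) + c * c ≡ 4 * (D * D) + c * c * 1
      lem₂ = solve-∀
    ... | false rewrite Σ-zero V | *-zeroʳ (4 * c) = z≤n

    summed : 4 * c * arcs p ≤ 2 * (c * arcs p) + c * c * c
    summed = begin
      4 * c * arcs p
        ≡⟨ Σ-*ˡ (4 * c) V d ⟨
      ∑ (λ u → 4 * c * d u)
        ≤⟨ Σ-mono V tangent ⟩
      ∑ (λ u → 4 * (d u * d u) + (c * c) * ⟦ p u ⟧)
        ≡⟨ Σ-+ V _ _ ⟩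
      ∑ (λ u → 4 * (d u * d u)) + ∑ (λ u → (c * c) * ⟦ p u ⟧)
        ≡⟨ cong₂ _+_ (Σ-*ˡ 4 V _) (Σ-*ˡ (c * c) V _) ⟩
      4 * dd + c * c * c
        ≡⟨ cong (_+ c * c * c) (*-assoc 2 2 dd) ⟩
      2 * (2 * dd) + c * c * c
        ≤⟨ +-monoˡ-≤ _ (*-monoʳ-≤ 2 degree-squares) ⟩
      2 * (c * arcs p) + c * c * c ∎

    scaled : c * (2 * arcs p) ≤ c * (c * c)
    scaled = +-cancelˡ-≤ (2 * (c * arcs p)) _ _ (begin
      2 * (c * arcs p) + c * (2 * arcs p)   ≡⟨ lem c (arcs p) ⟩
      4 * c * arcs p                        ≤⟨ summed ⟩
      2 * (c * arcs p) + c * c * c          ≡⟨ cong (2 * (c * arcs p) +_) (*-assoc c c c) ⟩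
      2 * (c * arcs p) + c * (c * c)        ∎)
      where
      lem : ∀ c a → 2 * (c * a) + c * (2 * a) ≡ 4 * c * a
      lem = solve-∀

    -- Serves the case c = 0, where `scaled` says nothing.
    arcs≤c² : arcs p ≤ c * c
    arcs≤c² = begin
      arcs p                                  ≤⟨ Σ-mono V (λ u → Σ-mono V (λ v → ⟦⟧-bound (edgeIn p u v) (λ h →
                                                   ≤-reflexive (sym (cong₂ _*_ (T⇒⟦⟧≡1 (proj₁ (edgeIn⁻ p h)))
                                                     (T⇒⟦⟧≡1 (proj₁ (proj₂ (edgeIn⁻ p h))))))))) ⟩
      ∑ (λ u → ∑ (λ v → ⟦ p u ⟧ * ⟦ p v ⟧))   ≡⟨ ΣΣ-* V V (λ u → ⟦ p u ⟧) (λ v → ⟦ p v ⟧) ⟩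
      c * c                                   ∎

    cancel : ∀ c' → c' ≡ c → 2 * arcs p ≤ c * c
    cancel zero     eq = ≤-trans (*-monoʳ-≤ 2 arcs≤c²) (subst (λ x → 2 * (x * x) ≤ x * x) eq z≤n)
    cancel (suc c') eq = *-cancelˡ-≤ (suc c') (subst (λ x → x * (2 * arcs p) ≤ x * (c * c)) (sym eq) scaled)

  -- Meant for deleting a class: `B` is the class, `W` holds its possible neighbours, and `B′` is
  -- what remains. An edge between `B` and `W` is two arcs, hence the factor 2.
  arcs-cover : ∀ (p B W B′ : Mask n) →
    (∀ u v → T (p u) → T (p v) → T (adj G u v) →
       (T (B u) × T (W v)) ⊎ (T (W u) × T (B v)) ⊎ (T (B′ u) × T (B′ v))) →
    arcs p ≤ 2 * (∣ B ∣ * ∣ W ∣) + arcs B′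
  arcs-cover p B W B′ cover = begin
    arcs p
      ≤⟨ Σ-mono V (λ u → Σ-mono V (λ v → ⟦⟧-bound (edgeIn p u v) (point u v))) ⟩
    ∑ (λ u → ∑ (λ v → ⟦ B u ⟧ * ⟦ W v ⟧ + (⟦ W u ⟧ * ⟦ B v ⟧ + ⟦ edgeIn B′ u v ⟧)))
      ≡⟨ trans (ΣΣ-+ V V _ _) (cong₂ _+_ (ΣΣ-* V V _ _) (trans (ΣΣ-+ V V _ _) (cong (_+ arcs B′) (ΣΣ-* V V _ _)))) ⟩
    ∣ B ∣ * ∣ W ∣ + (∣ W ∣ * ∣ B ∣ + arcs B′)
      ≡⟨ lem ∣ B ∣ ∣ W ∣ (arcs B′) ⟩
    2 * (∣ B ∣ * ∣ W ∣) + arcs B′ ∎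
    where
    open ≤-Reasoning
    V = allFin n
    lem : ∀ b w a → b * w + (w * b + a) ≡ 2 * (b * w) + a
    lem = solve-∀
    point : ∀ u v → T (edgeIn p u v) → 1 ≤ ⟦ B u ⟧ * ⟦ W v ⟧ + (⟦ W u ⟧ * ⟦ B v ⟧ + ⟦ edgeIn B′ u v ⟧)
    point u v h with pu , pv , uv ← edgeIn⁻ p h with cover u v pu pv uv
    ... | inj₁ (b , w)        rewrite T⇒⟦⟧≡1 b | T⇒⟦⟧≡1 w = s≤s z≤n
    ... | inj₂ (inj₁ (w , b)) rewrite T⇒⟦⟧≡1 b | T⇒⟦⟧≡1 w = m≤n⇒m≤o+n (⟦ B u ⟧ * ⟦ W v ⟧) (s≤s z≤n)
    ... | inj₂ (inj₂ (b , b′)) =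
      m≤n⇒m≤o+n (⟦ B u ⟧ * ⟦ W v ⟧) (m≤n⇒m≤o+n (⟦ W u ⟧ * ⟦ B v ⟧) (≤-reflexive (sym (T⇒⟦⟧≡1 (edgeIn⁺ B′ b b′ uv)))))

-- The numerical inequalities

module _ where

  open ≤-Reasoning

  -- f is the gap in Mantel's inequality for the triangle-free rest.  The two inequalities come
  -- from deleting a class (γ, or the union b of the other two) and applying Mantel again.
  deletion-arith : ∀ γ b s₁ s₂ z a f → 2 * a + f ≡ (γ + b + (s₁ + s₂) + z) * (γ + b + (s₁ + s₂) + z) →
    2 * a ≤ 4 * (γ * (s₁ + z)) + (b + (s₁ + s₂) + z) * (b + (s₁ + s₂) + z) →
    2 * a ≤ 4 * (b * (s₂ + z)) + (γ + (s₁ + s₂) + z) * (γ + (s₁ + s₂) + z) →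
    3 * (γ + b) * (γ * b) ≤ 4 * z * (γ * b) + f * (γ + b)
  deletion-arith γ b s₁ s₂ z a f eq h₁ h₂ = +-cancelʳ-≤ (γ * b * (4 * (s₁ + s₂) + 4 * z)) _ _ (begin
    3 * (γ + b) * (γ * b) + γ * b * (4 * (s₁ + s₂) + 4 * z)
      ≡⟨ lem γ b s₁ s₂ z ⟩
    -- The two deletion inequalities are weighted by b and γ, so that s₁ and s₂ occur on both sides
    -- with the same coefficient 4γb and cancel.
    b * (γ * γ + 2 * (γ * (b + (s₁ + s₂) + z))) + γ * (b * b + 2 * (b * (γ + (s₁ + s₂) + z)))
      ≤⟨ +-mono-≤ (*-monoʳ-≤ b (one γ (b + (s₁ + s₂) + z) (4 * (γ * (s₁ + z))) (trans eq (cong (λ x → x * x) (lem₁ γ b (s₁ + s₂) z))) h₁))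
                  (*-monoʳ-≤ γ (one b (γ + (s₁ + s₂) + z) (4 * (b * (s₂ + z))) (trans eq (cong (λ x → x * x) (lem₂ γ b (s₁ + s₂) z))) h₂)) ⟩
    b * (4 * (γ * (s₁ + z)) + f) + γ * (4 * (b * (s₂ + z)) + f)
      ≡⟨ lem₃ γ b s₁ s₂ z f ⟩
    4 * z * (γ * b) + f * (γ + b) + γ * b * (4 * (s₁ + s₂) + 4 * z) ∎)
    where
    lem : ∀ γ b s₁ s₂ z → 3 * (γ + b) * (γ * b) + γ * b * (4 * (s₁ + s₂) + 4 * z) ≡
      b * (γ * γ + 2 * (γ * (b + (s₁ + s₂) + z))) + γ * (b * b + 2 * (b * (γ + (s₁ + s₂) + z)))
    lem = solve-∀
    lem₁ : ∀ γ b s z → γ + b + s + z ≡ γ + (b + s + z)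
    lem₁ = solve-∀
    lem₂ : ∀ γ b s z → γ + b + s + z ≡ b + (γ + s + z)
    lem₂ = solve-∀
    lem₃ : ∀ γ b s₁ s₂ z f → b * (4 * (γ * (s₁ + z)) + f) + γ * (4 * (b * (s₂ + z)) + f) ≡
      4 * z * (γ * b) + f * (γ + b) + γ * b * (4 * (s₁ + s₂) + 4 * z)
    lem₃ = solve-∀
    one : ∀ x r y → 2 * a + f ≡ (x + r) * (x + r) → 2 * a ≤ y + r * r → x * x + 2 * (x * r) ≤ y + f
    one x r y eq h = +-cancelʳ-≤ (r * r) _ _ (begin
      x * x + 2 * (x * r) + r * r   ≡⟨ l x r ⟩
      (x + r) * (x + r)             ≡⟨ eq ⟨
      2 * a + f                     ≤⟨ +-monoˡ-≤ f h ⟩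
      y + r * r + f                 ≡⟨ l₂ y (r * r) f ⟩
      y + f + r * r                 ∎)
      where
      l : ∀ x r → x * x + 2 * (x * r) + r * r ≡ (x + r) * (x + r)
      l = solve-∀
      l₂ : ∀ a b c → a + b + c ≡ a + c + b
      l₂ = solve-∀

  squares : ℕ → ℕ → ℕ → ℕ
  squares α β γ = α * α + β * β + γ * γ

  products : ℕ → ℕ → ℕ → ℕ
  products α β γ = α * β + β * γ + γ * α

  -- z counts the vertices of the rest without neighbours in the triangle.
  core-arith : ∀ α β γ z t f → α + β + γ ≡ z + t →
    6 * products α β γ * (z + t) ≤ 8 * z * products α β γ + 3 * f * (z + t) →
    t * t ≤ 2 * squares α β γ + f
  core-arith α β γ z t f eq h with z + t in S≡
  ... | zero  = subst (λ x → x * x ≤ 2 * squares α β γ + f) (sym (m+n≡0⇒n≡0 z S≡)) z≤n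
  -- The hypothesis says f ≥ 2P - 8zP/(3S), and P ≤ S²/3. The factor 9S clears these denominators,
  -- and adding 18PS + 24zP on both sides replaces subtraction.
  ... | suc S′ = *-cancelˡ-≤ (9 * suc S′) (+-cancelʳ-≤ (18 * (P * S) + 24 * (z * P)) _ _ (begin
      9 * S * (t * t) + (18 * (P * S) + 24 * (z * P))
        ≡⟨ l₁ S P z t ⟩
      9 * S * (t * t) + (6 * S + 8 * z) * (3 * P)
        ≤⟨ +-monoʳ-≤ (9 * S * (t * t)) (*-monoʳ-≤ (6 * S + 8 * z) 3P≤S²) ⟩
      9 * S * (t * t) + (6 * S + 8 * z) * (S * S)
        ≤⟨ pure ⟩
      18 * S * (S * S)
        ≡⟨ cong (18 * S *_) S²≡ ⟩
      18 * S * (Q + 2 * P)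
        ≡⟨ l₂ S P Q ⟩
      18 * S * Q + 3 * (6 * P * S) + 18 * (P * S)
        ≤⟨ +-monoˡ-≤ (18 * (P * S)) (+-monoʳ-≤ (18 * S * Q) (*-monoʳ-≤ 3 h)) ⟩
      18 * S * Q + 3 * (8 * z * P + 3 * f * S) + 18 * (P * S)
        ≡⟨ l₃ S P Q z f ⟩
      9 * S * (2 * Q + f) + (18 * (P * S) + 24 * (z * P)) ∎))
    where
    S = suc S′
    P = products α β γ
    Q = squares α β γ
    l₁ : ∀ S P z t → 9 * S * (t * t) + (18 * (P * S) + 24 * (z * P)) ≡ 9 * S * (t * t) + (6 * S + 8 * z) * (3 * P)
    l₁ = solve-∀
    l₂ : ∀ S P Q → 18 * S * (Q + 2 * P) ≡ 18 * S * Q + 3 * (6 * P * S) + 18 * (P * S)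
    l₂ = solve-∀
    l₃ : ∀ S P Q z f → 18 * S * Q + 3 * (8 * z * P + 3 * f * S) + 18 * (P * S) ≡ 9 * S * (2 * Q + f) + (18 * (P * S) + 24 * (z * P))
    l₃ = solve-∀
    S²≡ : S * S ≡ Q + 2 * P
    S²≡ = trans (cong (λ x → x * x) (sym eq)) (l α β γ)
      where l : ∀ α β γ → (α + β + γ) * (α + β + γ) ≡ α * α + β * β + γ * γ + 2 * (α * β + β * γ + γ * α)
            l = solve-∀
    P≤Q : P ≤ Q
    P≤Q = *-cancelˡ-≤ 2 (begin
      2 * P ≡⟨ l α β γ ⟩
      2 * (α * β) + 2 * (β * γ) + 2 * (γ * α)
        ≤⟨ +-mono-≤ (+-mono-≤ (2xy≤x²+y² α β) (2xy≤x²+y² β γ)) (2xy≤x²+y² γ α) ⟩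
      α * α + β * β + (β * β + γ * γ) + (γ * γ + α * α) ≡⟨ l′ α β γ ⟩
      2 * Q ∎)
      where
      l : ∀ α β γ → 2 * (α * β + β * γ + γ * α) ≡ 2 * (α * β) + 2 * (β * γ) + 2 * (γ * α)
      l = solve-∀
      l′ : ∀ α β γ → α * α + β * β + (β * β + γ * γ) + (γ * γ + α * α) ≡ 2 * (α * α + β * β + γ * γ)
      l′ = solve-∀
    3P≤S² : 3 * P ≤ S * S
    3P≤S² = begin
      3 * P      ≡⟨ refl ⟩
      P + 2 * P  ≤⟨ +-monoˡ-≤ (2 * P) P≤Q ⟩
      Q + 2 * P  ≡⟨ S²≡ ⟨
      S * S ∎
    -- Divided by S this is 9t² + 8zS ≤ 12S²; with S = z + t the gap is 4z² + 16zt + 3t².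
    pure : 9 * S * (t * t) + (6 * S + 8 * z) * (S * S) ≤ 18 * S * (S * S)
    pure = begin
      9 * S * (t * t) + (6 * S + 8 * z) * (S * S)
        ≤⟨ m≤m+n _ (S * (4 * (z * z) + 16 * (z * t) + 3 * (t * t))) ⟩
      9 * S * (t * t) + (6 * S + 8 * z) * (S * S) + S * (4 * (z * z) + 16 * (z * t) + 3 * (t * t))
        ≡⟨ cong (λ y → 9 * S * (t * t) + (6 * S + 8 * z) * y + S * (4 * (z * z) + 16 * (z * t) + 3 * (t * t))) (S²) ⟩
      9 * S * (t * t) + (6 * S + 8 * z) * ((z + t) * (z + t)) + S * (4 * (z * z) + 16 * (z * t) + 3 * (t * t))
        ≡⟨ l S z t ⟩
      6 * S * ((z + t) * (z + t)) + 8 * z * ((z + t) * (z + t)) + S * (4 * (z * z) + 16 * (z * t) + 12 * (t * t))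
        ≡⟨ cong (λ y → 6 * S * ((z + t) * (z + t)) + 8 * z * (y * (z + t)) + S * (4 * (z * z) + 16 * (z * t) + 12 * (t * t))) S≡ ⟩
      6 * S * ((z + t) * (z + t)) + 8 * z * (S * (z + t)) + S * (4 * (z * z) + 16 * (z * t) + 12 * (t * t))
        ≡⟨ l₄ S z t ⟩
      18 * S * ((z + t) * (z + t))
        ≡⟨ cong (18 * S *_) S² ⟨
      18 * S * (S * S) ∎
      where
      S² : S * S ≡ (z + t) * (z + t)
      S² = cong (λ x → x * x) (sym S≡)
      l : ∀ S z t → 9 * S * (t * t) + (6 * S + 8 * z) * ((z + t) * (z + t)) + S * (4 * (z * z) + 16 * (z * t) + 3 * (t * t)) ≡
          6 * S * ((z + t) * (z + t)) + 8 * z * ((z + t) * (z + t)) + S * (4 * (z * z) + 16 * (z * t) + 12 * (t * t))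
      l = solve-∀
      l₄ : ∀ S z t → 6 * S * ((z + t) * (z + t)) + 8 * z * (S * (z + t)) + S * (4 * (z * z) + 16 * (z * t) + 12 * (t * t)) ≡
          18 * S * ((z + t) * (z + t))
      l₄ = solve-∀

  -- At most two of the three numbers are nonzero, and (x + y)² ≤ 2(x² + y²).
  core-arith-empty : ∀ α β γ z t f → α + β + γ ≡ z + t → α * (β * γ) ≡ 0 →
    t * t ≤ 2 * squares α β γ + f
  core-arith-empty α β γ z t f eq e = begin
    t * t                       ≤⟨ *-mono-≤ t≤S t≤S ⟩
    (α + β + γ) * (α + β + γ)   ≤⟨ two α β γ e ⟩
    2 * squares α β γ           ≤⟨ m≤m+n _ f ⟩
    2 * squares α β γ + f       ∎
    where
    t≤S : t ≤ α + β + γ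
    t≤S = subst (t ≤_) (sym eq) (m≤n+m t z)
    bin : ∀ x y → (x + y) * (x + y) ≤ 2 * (x * x + y * y)
    bin x y = begin
      (x + y) * (x + y)                     ≡⟨ l x y ⟩
      x * x + y * y + 2 * (x * y)           ≤⟨ +-monoʳ-≤ (x * x + y * y) (2xy≤x²+y² x y) ⟩
      x * x + y * y + (x * x + y * y)       ≡⟨ l′ x y ⟩
      2 * (x * x + y * y) ∎
      where
      l : ∀ x y → (x + y) * (x + y) ≡ x * x + y * y + 2 * (x * y)
      l = solve-∀
      l′ : ∀ x y → x * x + y * y + (x * x + y * y) ≡ 2 * (x * x + y * y)
      l′ = solve-∀
    two : ∀ α β γ → α * (β * γ) ≡ 0 → (α + β + γ) * (α + β + γ) ≤ 2 * squares α β γ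
    two zero    β γ _ = bin β γ
    two (suc α) zero γ _ = subst₂ _≤_ (l (suc α) γ) (l′ (suc α) γ) (bin (suc α) γ)
      where
      l : ∀ x y → (x + y) * (x + y) ≡ (x + 0 + y) * (x + 0 + y)
      l = solve-∀
      l′ : ∀ x y → 2 * (x * x + y * y) ≡ 2 * (x * x + 0 + y * y)
      l′ = solve-∀
    two (suc α) (suc β) zero _ = subst₂ _≤_ (l (suc α) (suc β)) (l′ (suc α) (suc β)) (bin (suc α) (suc β))
      where
      l : ∀ x y → (x + y) * (x + y) ≡ (x + y + 0) * (x + y + 0)
      l = solve-∀
      l′ : ∀ x y → 2 * (x * x + y * y) ≡ 2 * (x * x + y * y + 0)
      l′ = solve-∀
    two (suc α) (suc β) (suc γ) ()

  -- `P` and `R` count the adjacencies between the rest and the triangles and those among the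
  -- triangles, `Pₛ` and `Rₛ` the saturating pairs in the same places. `p` is the degree sum from
  -- the rest into the best triangle, and `S` and `z` count the vertices of the rest with two and
  -- with no neighbours in it.
  final-arith : ∀ m k a P R Pₛ Rₛ Q W p S z f → 1 ≤ k →
    2 * a + f ≡ m * m →
    (m + 3 * k) * (m + 3 * k) ≤ 2 * (a + 2 * P + R) →
    R ≤ 6 * (k * k) → P ≤ k * m + Pₛ → R ≤ 3 * (k * k) + Rₛ →
    P ≤ k * p → p + z ≡ S + m →
    Q + 2 * Pₛ + Rₛ ≤ W →
    (∀ t → S ≡ z + t → t * t ≤ 2 * Q + f) →
    4 * ((m + 3 * k) * (m + 3 * k)) ≤ 33 * W
  final-arith m k a P R Pₛ Rₛ Q W p S z f 1≤k eqf h₁ h₂ h₃ h₄ h₅ eqp h₆ core = *-cancelˡ-≤ 2 twice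
    where
    excess : 6 * (k * m) + 9 * (k * k) + f ≤ 4 * P + 2 * R
    excess = +-cancelˡ-≤ (2 * a) _ _ (begin
      2 * a + (6 * (k * m) + 9 * (k * k) + f)   ≡⟨ l a k m f ⟩
      2 * a + f + (6 * (k * m) + 9 * (k * k))   ≡⟨ cong (_+ (6 * (k * m) + 9 * (k * k))) eqf ⟩
      m * m + (6 * (k * m) + 9 * (k * k))       ≡⟨ l′ m k ⟩
      (m + 3 * k) * (m + 3 * k)                 ≤⟨ h₁ ⟩
      2 * (a + 2 * P + R)                       ≡⟨ l″ a P R ⟩
      2 * a + (4 * P + 2 * R)                   ∎)
      where
      l : ∀ a k m f → 2 * a + (6 * (k * m) + 9 * (k * k) + f) ≡ 2 * a + f + (6 * (k * m) + 9 * (k * k))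
      l = solve-∀
      l′ : ∀ m k → m * m + (6 * (k * m) + 9 * (k * k)) ≡ (m + 3 * k) * (m + 3 * k)
      l′ = solve-∀
      l″ : ∀ a P R → 2 * (a + 2 * P + R) ≡ 2 * a + (4 * P + 2 * R)
      l″ = solve-∀

    W-bound : 2 * Q + f + (2 * (k * m) + 3 * (k * k)) ≤ 2 * W
    W-bound = +-cancelʳ-≤ (4 * (k * m) + 6 * (k * k)) _ _ (begin
      2 * Q + f + (2 * (k * m) + 3 * (k * k)) + (4 * (k * m) + 6 * (k * k))
        ≡⟨ l Q f k m ⟩
      2 * Q + (6 * (k * m) + 9 * (k * k) + f)
        ≤⟨ +-monoʳ-≤ (2 * Q) excess ⟩
      2 * Q + (4 * P + 2 * R)
        ≤⟨ +-monoʳ-≤ (2 * Q) (+-mono-≤ (*-monoʳ-≤ 4 h₃) (*-monoʳ-≤ 2 h₄)) ⟩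
      2 * Q + (4 * (k * m + Pₛ) + 2 * (3 * (k * k) + Rₛ))
        ≡⟨ l′ Q (k * m) Pₛ (k * k) Rₛ ⟩
      2 * (Q + 2 * Pₛ + Rₛ) + (4 * (k * m) + 6 * (k * k))
        ≤⟨ +-monoˡ-≤ _ (*-monoʳ-≤ 2 h₆) ⟩
      2 * W + (4 * (k * m) + 6 * (k * k)) ∎)
      where
      l : ∀ Q f k m → 2 * Q + f + (2 * (k * m) + 3 * (k * k)) + (4 * (k * m) + 6 * (k * k)) ≡
          2 * Q + (6 * (k * m) + 9 * (k * k) + f)
      l = solve-∀
      l′ : ∀ Q km Pₛ kk Rₛ → 2 * Q + (4 * (km + Pₛ) + 2 * (3 * kk + Rₛ)) ≡ 2 * (Q + 2 * Pₛ + Rₛ) + (4 * km + 6 * kk)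
      l′ = solve-∀

    -- With `R` at most 6k², the excess of edges needs many crossing adjacencies, and the best
    -- triangle has at least the average share of them: 6m ≤ 4p + 3k. Replacing p by S + m - z gives
    -- the claim.
    linear : 2 * m + 4 * z ≤ 4 * S + 3 * k
    linear = +-cancelˡ-≤ (4 * m) _ _ (begin
      4 * m + (2 * m + 4 * z)         ≡⟨ l m z ⟩
      6 * m + 4 * z                   ≤⟨ +-monoˡ-≤ (4 * z) per-k ⟩
      4 * p + 3 * k + 4 * z           ≡⟨ l′ p k z ⟩
      4 * (p + z) + 3 * k             ≡⟨ cong (λ x → 4 * x + 3 * k) eqp ⟩
      4 * (S + m) + 3 * k             ≡⟨ l″ S m k ⟩
      4 * m + (4 * S + 3 * k)         ∎)
      where
      l : ∀ m z → 4 * m + (2 * m + 4 * z) ≡ 6 * m + 4 * z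
      l = solve-∀
      l′ : ∀ p k z → 4 * p + 3 * k + 4 * z ≡ 4 * (p + z) + 3 * k
      l′ = solve-∀
      l″ : ∀ S m k → 4 * (S + m) + 3 * k ≡ 4 * m + (4 * S + 3 * k)
      l″ = solve-∀
      scaled : k * (6 * m) ≤ k * (4 * p + 3 * k)
      scaled = +-cancelʳ-≤ (9 * (k * k)) _ _ (begin
        k * (6 * m) + 9 * (k * k)              ≡⟨ c k m ⟩
        6 * (k * m) + 9 * (k * k)              ≤⟨ m≤m+n _ f ⟩
        6 * (k * m) + 9 * (k * k) + f          ≤⟨ excess ⟩
        4 * P + 2 * R                          ≤⟨ +-mono-≤ (*-monoʳ-≤ 4 h₅) (*-monoʳ-≤ 2 h₂) ⟩
        4 * (k * p) + 2 * (6 * (k * k))        ≡⟨ c′ k p ⟩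
        k * (4 * p + 3 * k) + 9 * (k * k)      ∎)
        where
        c : ∀ k m → k * (6 * m) + 9 * (k * k) ≡ 6 * (k * m) + 9 * (k * k)
        c = solve-∀
        c′ : ∀ k p → 4 * (k * p) + 2 * (6 * (k * k)) ≡ k * (4 * p + 3 * k) + 9 * (k * k)
        c′ = solve-∀
      per-k : 6 * m ≤ 4 * p + 3 * k
      per-k = *-cancelˡ-≤ k {{>-nonZero 1≤k}} scaled

    -- Reduces the claim to 8n² ≤ 33(2Q + f + 2km + 3k²), which no longer mentions W.
    from : (m + 3 * k) * (m + 3 * k) * 8 ≤ (2 * Q + f + (2 * (k * m) + 3 * (k * k))) * 33 →
           2 * (4 * ((m + 3 * k) * (m + 3 * k))) ≤ 2 * (33 * W)
    from h = begin
      2 * (4 * ((m + 3 * k) * (m + 3 * k)))                 ≡⟨ l ((m + 3 * k) * (m + 3 * k)) ⟩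
      (m + 3 * k) * (m + 3 * k) * 8                         ≤⟨ h ⟩
      (2 * Q + f + (2 * (k * m) + 3 * (k * k))) * 33        ≤⟨ *-monoˡ-≤ 33 W-bound ⟩
      2 * W * 33                                            ≡⟨ l′ W ⟩
      2 * (33 * W)                                          ∎
      where l : ∀ X → 2 * (4 * X) ≡ X * 8
            l = solve-∀
            l′ : ∀ W → 2 * W * 33 ≡ 2 * (33 * W)
            l′ = solve-∀

    twice : 2 * (4 * ((m + 3 * k) * (m + 3 * k))) ≤ 2 * (33 * W)
    twice = [ small , large ]′ (≤-total (2 * m) (3 * k))
      where
      -- Here `linear` gives no useful bound on S - z, but 2km + 3k² alone is large enough.
      small : 2 * m ≤ 3 * k → _
      small 2m≤3k = from (begin
        (m + 3 * k) * (m + 3 * k) * 8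
          ≡⟨ l m k ⟩
        m * 4 * (2 * m) + (k * m * 48 + k * k * 72)
          ≤⟨ +-monoˡ-≤ _ (*-monoʳ-≤ (m * 4) 2m≤3k) ⟩
        m * 4 * (3 * k) + (k * m * 48 + k * k * 72)
          ≤⟨ m≤m+n _ ((2 * Q + f) * 33 + k * m * 6 + k * k * 27) ⟩
        m * 4 * (3 * k) + (k * m * 48 + k * k * 72) + ((2 * Q + f) * 33 + k * m * 6 + k * k * 27)
          ≡⟨ l′ m k (2 * Q + f) ⟩
        (2 * Q + f + (2 * (k * m) + 3 * (k * k))) * 33 ∎)
        where
        l : ∀ m k → (m + 3 * k) * (m + 3 * k) * 8 ≡ m * 4 * (2 * m) + (k * m * 48 + k * k * 72)
        l = solve-∀
        l′ : ∀ m k q → m * 4 * (3 * k) + (k * m * 48 + k * k * 72) + (q * 33 + k * m * 6 + k * k * 27) ≡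
             (q + (2 * (k * m) + 3 * (k * k))) * 33
        l′ = solve-∀
      -- With j = 2m − 3k the slack is (j − 24k)², which vanishes at k = 2n/33, where n = m + 3k.
      large : 3 * k ≤ 2 * m → _
      large 3k≤2m = from (*-cancelʳ-≤ _ _ 16 (begin
        (m + 3 * k) * (m + 3 * k) * 8 * 16
          ≡⟨ l m k ⟩
        (2 * m + k * 6) * (2 * m + k * 6) * 32
          ≡⟨ cong (λ x → (x + k * 6) * (x + k * 6) * 32) 3k+j≡2m ⟨
        (3 * k + j + k * 6) * (3 * k + j + k * 6) * 32
          ≡⟨ l₁ k j ⟩
        2 * (j * (k * 24)) + (j * j * 32 + k * k * 2592 + k * j * 528)
          ≤⟨ +-monoˡ-≤ _ (2xy≤x²+y² j (k * 24)) ⟩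
        j * j + (k * 24) * (k * 24) + (j * j * 32 + k * k * 2592 + k * j * 528)
          ≡⟨ l₂ k j ⟩
        j * j * 33 + (k * (3 * k + j) * 528 + k * k * 1584)
          ≤⟨ +-monoˡ-≤ _ (*-monoˡ-≤ 33 j²≤16q) ⟩
        (2 * Q + f) * 16 * 33 + (k * (3 * k + j) * 528 + k * k * 1584)
          ≡⟨ cong (λ x → (2 * Q + f) * 16 * 33 + (k * x * 528 + k * k * 1584)) 3k+j≡2m ⟩
        (2 * Q + f) * 16 * 33 + (k * (2 * m) * 528 + k * k * 1584)
          ≡⟨ l₃ m k (2 * Q + f) ⟩
        (2 * Q + f + (2 * (k * m) + 3 * (k * k))) * 33 * 16 ∎))
        where
        j : ℕ
        j = proj₁ (m≤n⇒∃[o]m+o≡n 3k≤2m)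
        3k+j≡2m : 3 * k + j ≡ 2 * m
        3k+j≡2m = proj₂ (m≤n⇒∃[o]m+o≡n 3k≤2m)
        j+4z≤4S : j + 4 * z ≤ 4 * S
        j+4z≤4S = +-cancelˡ-≤ (3 * k) _ _ (begin
          3 * k + (j + 4 * z)   ≡⟨ +-assoc (3 * k) j (4 * z) ⟨
          3 * k + j + 4 * z     ≡⟨ cong (_+ 4 * z) 3k+j≡2m ⟩
          2 * m + 4 * z         ≤⟨ linear ⟩
          4 * S + 3 * k         ≡⟨ +-comm (4 * S) (3 * k) ⟩
          3 * k + 4 * S         ∎)
        z≤S : z ≤ S
        z≤S = *-cancelˡ-≤ 4 (≤-trans (m≤n+m (4 * z) j) j+4z≤4S)
        t : ℕ
        t = proj₁ (m≤n⇒∃[o]m+o≡n z≤S)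
        z+t≡S : z + t ≡ S
        z+t≡S = proj₂ (m≤n⇒∃[o]m+o≡n z≤S)
        j≤4t : j ≤ 4 * t
        j≤4t = +-cancelʳ-≤ (4 * z) _ _ (begin
          j + 4 * z        ≤⟨ j+4z≤4S ⟩
          4 * S            ≡⟨ cong (4 *_) z+t≡S ⟨
          4 * (z + t)      ≡⟨ *-distribˡ-+ 4 z t ⟩
          4 * z + 4 * t    ≡⟨ +-comm (4 * z) (4 * t) ⟩
          4 * t + 4 * z    ∎)
        j²≤16q : j * j ≤ (2 * Q + f) * 16
        j²≤16q = begin
          j * j                  ≤⟨ *-mono-≤ j≤4t j≤4t ⟩
          4 * t * (4 * t)        ≡⟨ c t ⟩
          t * t * 16             ≤⟨ *-monoˡ-≤ 16 (core t (sym z+t≡S)) ⟩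
          (2 * Q + f) * 16       ∎
          where
          c : ∀ t → 4 * t * (4 * t) ≡ t * t * 16
          c = solve-∀
        l : ∀ m k → (m + 3 * k) * (m + 3 * k) * 8 * 16 ≡ (2 * m + k * 6) * (2 * m + k * 6) * 32
        l = solve-∀
        l₁ : ∀ k j → (3 * k + j + k * 6) * (3 * k + j + k * 6) * 32 ≡
             2 * (j * (k * 24)) + (j * j * 32 + k * k * 2592 + k * j * 528)
        l₁ = solve-∀
        l₂ : ∀ k j → j * j + (k * 24) * (k * 24) + (j * j * 32 + k * k * 2592 + k * j * 528) ≡
             j * j * 33 + (k * (3 * k + j) * 528 + k * k * 1584)
        l₂ = solve-∀
        l₃ : ∀ m k q → q * 16 * 33 + (k * (2 * m) * 528 + k * k * 1584) ≡
             (q + (2 * (k * m) + 3 * (k * k))) * 33 * 16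
        l₃ = solve-∀

-- One triangle against a triangle-free set

T-∨⁻ : ∀ {x y} → T (x ∨ y) → T x ⊎ T y
T-∨⁻ = Equivalence.to T-∨

T-not : ∀ {x} → ¬ T x → T (not x)
T-not {true}  h = h tt
T-not {false} h = tt

any-allFin : ∀ {n} (p : Fin n → Bool) w → T (p w) → T (any p (allFin n))
any-allFin p w h = any⁺ p (lose (∈-allFin w) h)

any-allFin⁻ : ∀ {n} (p : Fin n → Bool) → T (any p (allFin n)) → ∃ λ w → T (p w)
any-allFin⁻ {n} p h = Any.satisfied (any⁻ p (allFin n) h)

T-ext : ∀ {a b} → (T a → T b) → (T b → T a) → a ≡ b
T-ext {true}  {true}  f g = refl
T-ext {true}  {false} f g = ⊥-elim (f tt)
T-ext {false} {true}  f g = ⊥-elim (g tt)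
T-ext {false} {false} f g = refl

module _ {n} (G : Graph n) where

  sat⇒common-edge : ∀ {u v} → T (saturating G u v) → ∃ λ p → ∃ λ q →
    T (adj G p q) × T (adj G p u) × T (adj G q u) × T (adj G p v) × T (adj G q v)
  sat⇒common-edge {u} {v} h
    with p , h₁ ← any-allFin⁻ _ (proj₂ (∧-T {not (adj G u v)} h))
    with q , h₂ ← any-allFin⁻ _ h₁
    with pu , h₃ ← ∧-T {adj G u p} h₂
    with qu , h₄ ← ∧-T {adj G u q} h₃
    with pv , h₅ ← ∧-T {adj G v p} h₄
    with qv , pq ← ∧-T {adj G v q} h₅ =
    p , q , pq , adj-sym G pu , adj-sym G qu , adj-sym G pv , adj-sym G qv

  module _ (free : K4Free G) where

    common-edge⇒sat : ∀ {p q u v} → T (adj G p q) → T (adj G p u) → T (adj G q u) → T (adj G p v) → T (adj G q v) →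
                      T (saturating G u v)
    common-edge⇒sat {p} {q} {u} {v} pq pu qu pv qv = T-∧⁺ (T-not (λ uv → free p q u v pq pu pv qu qv uv))
      (any-allFin _ p (any-allFin _ q (T-∧⁺ (adj-sym G pu) (T-∧⁺ (adj-sym G qu) (T-∧⁺ (adj-sym G pv) (T-∧⁺ (adj-sym G qv) pq))))))

    saturating-sym : ∀ u v → saturating G u v ≡ saturating G v u
    saturating-sym u v = T-ext flip flip
      where
      flip : ∀ {u v} → T (saturating G u v) → T (saturating G v u)
      flip h with p , q , pq , pu , qu , pv , qv ← sat⇒common-edge h = common-edge⇒sat pq pv qv pu qu

-- The three Booleans are the type of a vertex: whether it is adjacent to x, to y, to z. Facts about
-- types are checked by evaluating all 8 of them, or all 64 pairs, so that `tt` proves them.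
Cube : Set → Set
Cube A = Bool → Bool → Bool → A

all₁ : (Bool → Bool) → Bool
all₁ f = f true ∧ f false

all₁-sound : ∀ f → T (all₁ f) → ∀ b → T (f b)
all₁-sound f h true  = proj₁ (∧-T h)
all₁-sound f h false = proj₂ (∧-T {f true} h)

all₃ : Cube Bool → Bool
all₃ f = all₁ λ a → all₁ λ b → all₁ λ c → f a b c

all₃-sound : ∀ f → T (all₃ f) → ∀ a b c → T (f a b c)
all₃-sound f h a b c = all₁-sound (f a b) (all₁-sound (λ b → all₁ (f a b)) (all₁-sound (λ a → all₁ λ b → all₁ (f a b)) h a) b) c

all₆ : Cube (Cube Bool) → Bool
all₆ f = all₃ λ a b c → all₃ (f a b c)

all₆-sound : ∀ f → T (all₆ f) → ∀ a b c a′ b′ c′ → T (f a b c a′ b′ c′)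
all₆-sound f h a b c = all₃-sound (f a b c) (all₃-sound (λ a b c → all₃ (f a b c)) h a b c)

Σ-positive : ∀ {n} (p : Fin n → Bool) → ∣ p ∣ ≡ 0 ⊎ ∃ λ v → T (p v)
Σ-positive {n} p = go (allFin n)
  where
  go : ∀ xs → Σ xs (λ v → ⟦ p v ⟧) ≡ 0 ⊎ ∃ λ v → T (p v)
  go [] = inj₁ refl
  go (x ∷ xs) with p x in eq | go xs
  ... | true  | _      = inj₂ (x , subst T (sym eq) tt)
  ... | false | inj₁ h = inj₁ h
  ... | false | inj₂ h = inj₂ h

deg : Cube ℕ
deg a b c = ⟦ a ⟧ + ⟦ b ⟧ + ⟦ c ⟧

xy xz yz ox oy oz none : Cube Bool
xy a b c = (a ∧ b) ∧ not c
xz a b c = (a ∧ c) ∧ not b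
yz a b c = (b ∧ c) ∧ not a
ox a b c = (a ∧ not b) ∧ not c
oy a b c = (b ∧ not a) ∧ not c
oz a b c = (c ∧ not a) ∧ not b
none a b c = not (a ∨ (b ∨ c))

_∪_ : Cube Bool → Cube Bool → Cube Bool
(κ ∪ ξ) a b c = κ a b c ∨ ξ a b c

∁ : Cube Bool → Cube Bool
∁ κ a b c = not (κ a b c)

full : Cube Bool
full a b c = a ∧ (b ∧ c)

ind : Cube Bool → Cube ℕ
ind κ a b c = ⟦ κ a b c ⟧

-- The type 111 is skipped: a vertex adjacent to a whole triangle spans a K₄ with it.
agree : List (Cube ℕ) → List (Cube ℕ) → Bool
agree ws ws′ = all₃ λ a b c → full a b c ∨ (Σ ws (λ w → w a b c) ≡ᵇ Σ ws′ (λ w → w a b c))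

-- When the neighbourhoods of x, y and z are independent, adjacent vertices have disjoint types,
-- so only pairs of disjoint types have to be covered.
separates : (B W : Cube Bool) → Cube (Cube Bool)
separates B W a b c a′ b′ c′ =
  (full a b c ∨ full a′ b′ c′) ∨ (((a ∧ a′) ∨ ((b ∧ b′) ∨ (c ∧ c′))) ∨
  ((B a b c ∧ W a′ b′ c′) ∨ ((W a b c ∧ B a′ b′ c′) ∨ (∁ B a b c ∧ ∁ B a′ b′ c′))))

module _ {n} (G : Graph n) (r : Mask n) where

  Independent : Fin n → Set
  Independent o = ∀ v w → T (r v) → T (r w) → T (adj G o v) → T (adj G o w) → T (adj G v w) → ⊥

  -- A vertex u adjacent to p and q can take the place of o in the triangle pqo. An edge of the rest
  -- inside the neighbourhood of the released o would then give a second triangle.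
  Unswappable : Fin n → Fin n → Fin n → Set
  Unswappable p q o = ∀ u → T (r u) → T (adj G p u) → T (adj G q u) → Independent o

module Triangle {n} (G : Graph n) (free : K4Free G) (r : Mask n) (tf : TriangleFree G r)
  (x y z : Fin n) (x-y : T (adj G x y)) (x-z : T (adj G x z)) (y-z : T (adj G y z)) where

  private V = allFin n

  at : ∀ {A : Set} → Cube A → Fin n → A
  at κ v = κ (adj G x v) (adj G y v) (adj G z v)

  not-full : ∀ v → ¬ T (at full v)
  not-full v h with a , bc ← ∧-T {adj G x v} h with b , c ← ∧-T {adj G y v} bc =
    free x y z v x-y x-z a y-z b c

  weight : Cube ℕ → ℕ
  weight w = ∑ (λ v → ⟦ r v ⟧ * at w v)

  Σ-weight : ∀ ws → Σ ws weight ≡ ∑ (λ v → ⟦ r v ⟧ * Σ ws (λ w → at w v))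
  Σ-weight ws = trans (Σ-swap ws V (λ w v → ⟦ r v ⟧ * at w v)) (Σ-cong V (λ v → Σ-*ˡ ⟦ r v ⟧ ws (λ w → at w v)))

  -- Lifts an identity between functions of the type, checked on the seven types that can occur, to
  -- the corresponding sums over the rest.
  weights-agree : ∀ ws ws′ → T (agree ws ws′) → Σ ws weight ≡ Σ ws′ weight
  weights-agree ws ws′ h = trans (Σ-weight ws) (trans (Σ-cong V (λ v → cong (⟦ r v ⟧ *_) (point v))) (sym (Σ-weight ws′)))
    where
    point : ∀ v → Σ ws (λ w → at w v) ≡ Σ ws′ (λ w → at w v)
    point v with T-∨⁻ {at full v} (all₃-sound (λ a b c → full a b c ∨ (Σ ws (λ w → w a b c) ≡ᵇ Σ ws′ (λ w → w a b c))) h _ _ _)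
    ... | inj₁ f = ⊥-elim (not-full v f)
    ... | inj₂ e = ≡ᵇ⇒≡ _ _ e

  # : Cube Bool → ℕ
  # κ = weight (ind κ)

  cls : Cube Bool → Mask n
  cls κ v = r v ∧ at κ v

  ∣cls∣ : ∀ κ → ∣ cls κ ∣ ≡ # κ
  ∣cls∣ κ = Σ-cong V (λ v → ⟦⟧-∧ (r v) (at κ v))

  ∣r∣ : ∣ r ∣ ≡ weight (λ _ _ _ → 1)
  ∣r∣ = Σ-cong V (λ v → sym (*-identityʳ ⟦ r v ⟧))

  satIn : Fin n → Fin n → Bool
  satIn u v = (r u ∧ r v) ∧ saturating G u v

  -- Two vertices of one class are both joined to the ends of the same edge of the triangle. The
  -- pairs with u = v belong to the squares and are saturating in the same sense.
  squares≤sat : squares (# xy) (# xz) (# yz) ≤ ∑ (λ u → ∑ (λ v → ⟦ satIn u v ⟧))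
  squares≤sat = begin
    # xy * # xy + # xz * # xz + # yz * # yz
      ≡⟨ cong₂ _+_ (cong₂ _+_ (sq xy) (sq xz)) (sq yz) ⟩
    ∑ (λ u → ∑ (f xy u)) + ∑ (λ u → ∑ (f xz u)) + ∑ (λ u → ∑ (f yz u))
      ≡⟨ trans (ΣΣ-+ V V (λ u v → f xy u v + f xz u v) (f yz)) (cong (_+ ∑ (λ u → ∑ (f yz u))) (ΣΣ-+ V V (f xy) (f xz))) ⟨
    ∑ (λ u → ∑ (λ v → f xy u v + f xz u v + f yz u v))
      ≤⟨ Σ-mono V (λ u → Σ-mono V (λ v → point u v)) ⟩
    ∑ (λ u → ∑ (λ v → ⟦ satIn u v ⟧)) ∎
    where
    open ≤-Reasoning
    f : Cube Bool → Fin n → Fin n → ℕ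
    f κ u v = (⟦ r u ⟧ * at (ind κ) u) * (⟦ r v ⟧ * at (ind κ) v)
    sq : ∀ κ → # κ * # κ ≡ ∑ (λ u → ∑ (f κ u))
    sq κ = sym (ΣΣ-* V V (λ u → ⟦ r u ⟧ * at (ind κ) u) (λ v → ⟦ r v ⟧ * at (ind κ) v))
    twoShared : Bool → Bool → Bool → Bool → Bool → Bool → Bool
    twoShared a b c a′ b′ c′ = ((a ∧ b) ∧ (a′ ∧ b′)) ∨ (((a ∧ c) ∧ (a′ ∧ c′)) ∨ ((b ∧ c) ∧ (b′ ∧ c′)))
    bound : Cube (Cube Bool)
    bound a b c a′ b′ c′ = (ind xy a b c * ind xy a′ b′ c′ + ind xz a b c * ind xz a′ b′ c′ + ind yz a b c * ind yz a′ b′ c′)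
                                ≤ᵇ ⟦ twoShared a b c a′ b′ c′ ⟧
    shared⇒sat : ∀ u v → T (twoShared (adj G x u) (adj G y u) (adj G z u) (adj G x v) (adj G y v) (adj G z v)) → T (saturating G u v)
    shared⇒sat u v h with T-∨⁻ {(adj G x u ∧ adj G y u) ∧ (adj G x v ∧ adj G y v)} h
    ... | inj₁ k with k₁ , k₂ ← ∧-T {adj G x u ∧ adj G y u} k with a , b ← ∧-T {adj G x u} k₁ with c , d ← ∧-T {adj G x v} k₂ =
      common-edge⇒sat G free x-y a b c d
    ... | inj₂ h′ with T-∨⁻ {(adj G x u ∧ adj G z u) ∧ (adj G x v ∧ adj G z v)} h′
    ...   | inj₁ k with k₁ , k₂ ← ∧-T {adj G x u ∧ adj G z u} k with a , b ← ∧-T {adj G x u} k₁ with c , d ← ∧-T {adj G x v} k₂ =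
      common-edge⇒sat G free x-z a b c d
    ...   | inj₂ k with k₁ , k₂ ← ∧-T {adj G y u ∧ adj G z u} k with a , b ← ∧-T {adj G y u} k₁ with c , d ← ∧-T {adj G y v} k₂ =
      common-edge⇒sat G free y-z a b c d
    -- The classes are disjoint, so at most one of the three products is 1.
    point : ∀ u v → f xy u v + f xz u v + f yz u v ≤ ⟦ satIn u v ⟧
    point u v = begin
      f xy u v + f xz u v + f yz u v
        ≡⟨ lem ⟦ r u ⟧ ⟦ r v ⟧ (at (ind xy) u) (at (ind xy) v) (at (ind xz) u) (at (ind xz) v) (at (ind yz) u) (at (ind yz) v) ⟩
      ⟦ r u ⟧ * ⟦ r v ⟧ * (at (ind xy) u * at (ind xy) v + at (ind xz) u * at (ind xz) v + at (ind yz) u * at (ind yz) v)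
        ≤⟨ *-monoʳ-≤ (⟦ r u ⟧ * ⟦ r v ⟧) (≤ᵇ⇒≤ _ _ (all₆-sound bound tt (adj G x u) (adj G y u) (adj G z u) (adj G x v) (adj G y v) (adj G z v))) ⟩
      ⟦ r u ⟧ * ⟦ r v ⟧ * ⟦ twoShared (adj G x u) (adj G y u) (adj G z u) (adj G x v) (adj G y v) (adj G z v) ⟧
        ≤⟨ *-monoʳ-≤ (⟦ r u ⟧ * ⟦ r v ⟧) (⟦⟧-bound _ (λ h → ≤-reflexive (sym (T⇒⟦⟧≡1 (shared⇒sat u v h))))) ⟩
      ⟦ r u ⟧ * ⟦ r v ⟧ * ⟦ saturating G u v ⟧
        ≡⟨ cong (_* ⟦ saturating G u v ⟧) (⟦⟧-∧ (r u) (r v)) ⟨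
      ⟦ r u ∧ r v ⟧ * ⟦ saturating G u v ⟧
        ≡⟨ ⟦⟧-∧ (r u ∧ r v) (saturating G u v) ⟨
      ⟦ satIn u v ⟧ ∎
      where
      lem : ∀ p q a a′ b b′ c c′ → (p * a) * (q * a′) + (p * b) * (q * b′) + (p * c) * (q * c′) ≡
                                   p * q * (a * a′ + b * b′ + c * c′)
      lem = solve-∀

  -- Independence of the three neighbourhoods makes the types of adjacent vertices disjoint, so
  -- every arc that meets `B` joins it to `W`. Mantel's theorem bounds the arcs that avoid `B`.
  delete : Independent G r x → Independent G r y → Independent G r z → ∀ B W → T (all₆ (separates B W)) →
           2 * arcs G r ≤ 4 * (# B * # W) + # (∁ B) * # (∁ B)
  delete ix iy iz B W sep = begin
    2 * arcs G r
      ≤⟨ *-monoʳ-≤ 2 (arcs-cover G r (cls B) (cls W) (cls (∁ B)) cover) ⟩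
    2 * (2 * (∣ cls B ∣ * ∣ cls W ∣) + arcs G (cls (∁ B)))
      ≡⟨ lem (∣ cls B ∣ * ∣ cls W ∣) _ ⟩
    4 * (∣ cls B ∣ * ∣ cls W ∣) + 2 * arcs G (cls (∁ B))
      ≤⟨ +-monoʳ-≤ (4 * (∣ cls B ∣ * ∣ cls W ∣)) (mantel G (cls (∁ B)) (λ u v w pu pv pw → tf u v w (proj₁ (∧-T pu)) (proj₁ (∧-T pv)) (proj₁ (∧-T pw)))) ⟩
    4 * (∣ cls B ∣ * ∣ cls W ∣) + ∣ cls (∁ B) ∣ * ∣ cls (∁ B) ∣
      ≡⟨ cong₂ _+_ (cong (4 *_) (cong₂ _*_ (∣cls∣ B) (∣cls∣ W))) (cong₂ _*_ (∣cls∣ (∁ B)) (∣cls∣ (∁ B))) ⟩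
    4 * (# B * # W) + # (∁ B) * # (∁ B) ∎
    where
    open ≤-Reasoning
    lem : ∀ p q → 2 * (2 * p + q) ≡ 4 * p + 2 * q
    lem = solve-∀
    cover : ∀ u v → T (r u) → T (r v) → T (adj G u v) →
       (T (cls B u) × T (cls W v)) ⊎ (T (cls W u) × T (cls B v)) ⊎ (T (cls (∁ B) u) × T (cls (∁ B) v))
    cover u v ru rv uv with T-∨⁻ {at full u ∨ at full v} (all₆-sound (separates B W) sep (adj G x u) (adj G y u) (adj G z u) (adj G x v) (adj G y v) (adj G z v))
    ... | inj₁ f with T-∨⁻ {at full u} f
    ...   | inj₁ f₁ = ⊥-elim (not-full u f₁)
    ...   | inj₂ f₂ = ⊥-elim (not-full v f₂)
    cover u v ru rv uv | inj₂ h with T-∨⁻ {(adj G x u ∧ adj G x v) ∨ ((adj G y u ∧ adj G y v) ∨ (adj G z u ∧ adj G z v))} h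
    ... | inj₁ s with T-∨⁻ {adj G x u ∧ adj G x v} s
    ...   | inj₁ s₁ = let p , q = ∧-T {adj G x u} s₁ in ⊥-elim (ix u v ru rv p q uv)
    ...   | inj₂ s′ with T-∨⁻ {adj G y u ∧ adj G y v} s′
    ...     | inj₁ s₂ = let p , q = ∧-T {adj G y u} s₂ in ⊥-elim (iy u v ru rv p q uv)
    ...     | inj₂ s₃ = let p , q = ∧-T {adj G z u} s₃ in ⊥-elim (iz u v ru rv p q uv)
    cover u v ru rv uv | inj₂ h | inj₂ t with T-∨⁻ {at B u ∧ at W v} t
    ... | inj₁ bw = let p , q = ∧-T {at B u} bw in inj₁ (T-∧⁺ ru p , T-∧⁺ rv q)
    ... | inj₂ t′ with T-∨⁻ {at W u ∧ at B v} t′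
    ...   | inj₁ wb = let p , q = ∧-T {at W u} wb in inj₂ (inj₁ (T-∧⁺ ru p , T-∧⁺ rv q))
    ...   | inj₂ bb = let p , q = ∧-T {at (∁ B) u} bb in inj₂ (inj₂ (T-∧⁺ ru p , T-∧⁺ rv q))

  f : ℕ
  f = ∣ r ∣ * ∣ r ∣ ∸ 2 * arcs G r

  deficiency : 2 * arcs G r + f ≡ ∣ r ∣ * ∣ r ∣
  deficiency = m+[n∸m]≡n (mantel G r tf)

  -- `g` is one class and `b` the union of the other two; `s` and `t` are the types with one
  -- neighbour that can be adjacent to `g` and to `b`. For example, vertices of type `xy` can be
  -- adjacent only to those of type `oz` or `none`. The Boolean arguments express this and the
  -- partition of the rest into five parts.
  split : Independent G r x → Independent G r y → Independent G r z → ∀ g b s t →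
    T (all₆ (separates g (s ∪ none))) → T (all₆ (separates b (t ∪ none))) →
    T (agree ((λ _ _ _ → 1) ∷ []) (ind g ∷ ind b ∷ ind s ∷ ind t ∷ ind none ∷ [])) →
    T (agree (ind (∁ g) ∷ []) (ind b ∷ ind s ∷ ind t ∷ ind none ∷ [])) →
    T (agree (ind (∁ b) ∷ []) (ind g ∷ ind s ∷ ind t ∷ ind none ∷ [])) →
    T (agree (ind (s ∪ none) ∷ []) (ind s ∷ ind none ∷ [])) →
    T (agree (ind (t ∪ none) ∷ []) (ind t ∷ ind none ∷ [])) →
    3 * (# g + # b) * (# g * # b) ≤ 4 * # none * (# g * # b) + f * (# g + # b)
  split ix iy iz g b s t sep₁ sep₂ e₁ e₂ e₃ e₄ e₅ =
    deletion-arith (# g) (# b) (# s) (# t) (# none) (arcs G r) f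
      (trans deficiency (cong (λ m → m * m) (trans ∣r∣ (trans (eq₁ (λ _ _ _ → 1) (ind g ∷ ind b ∷ ind s ∷ ind t ∷ ind none ∷ []) e₁) (l₅ (# g) (# b) (# s) (# t) (# none))))))
      (subst₂ (λ w c → 2 * arcs G r ≤ 4 * (# g * w) + c * c)
        (trans (eq₁ (ind (s ∪ none)) (ind s ∷ ind none ∷ []) e₄) (l₂ (# s) (# none)))
        (trans (eq₁ (ind (∁ g)) (ind b ∷ ind s ∷ ind t ∷ ind none ∷ []) e₂) (l₄ (# b) (# s) (# t) (# none)))
        (delete ix iy iz g (s ∪ none) sep₁))
      (subst₂ (λ w c → 2 * arcs G r ≤ 4 * (# b * w) + c * c)
        (trans (eq₁ (ind (t ∪ none)) (ind t ∷ ind none ∷ []) e₅) (l₂ (# t) (# none)))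
        (trans (eq₁ (ind (∁ b)) (ind g ∷ ind s ∷ ind t ∷ ind none ∷ []) e₃) (l₄ (# g) (# s) (# t) (# none)))
        (delete ix iy iz b (t ∪ none) sep₂))
    where
    eq₁ : ∀ w ws → T (agree (w ∷ []) ws) → weight w ≡ Σ ws weight
    eq₁ w ws h = trans (sym (+-identityʳ (weight w))) (weights-agree (w ∷ []) ws h)
    l₂ : ∀ a b → a + (b + 0) ≡ a + b
    l₂ = solve-∀
    l₄ : ∀ a b c d → a + (b + (c + (d + 0))) ≡ a + (b + c) + d
    l₄ = solve-∀
    l₅ : ∀ e a b c d → e + (a + (b + (c + (d + 0)))) ≡ e + a + (b + c) + d
    l₅ = solve-∀

  S : ℕ
  S = # xy + # xz + # yz

  -- A vertex of type `xy` can replace z, so its existence makes the neighbourhood of z independent,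
  -- and similarly for the other two. Adding the three ways of singling out one class then makes the
  -- bound symmetric.
  core : Unswappable G r x y z → Unswappable G r x z y → Unswappable G r y z x → ∀ t → S ≡ # none + t →
         t * t ≤ 2 * squares (# xy) (# xz) (# yz) + f
  core sz sy sx t eq with Σ-positive (cls xy) | Σ-positive (cls xz) | Σ-positive (cls yz)
  ... | inj₁ e | _ | _ = core-arith-empty (# xy) (# xz) (# yz) (# none) t f eq
        (cong (_* (# xz * # yz)) (trans (sym (∣cls∣ xy)) e))
  ... | _ | inj₁ e | _ = core-arith-empty (# xy) (# xz) (# yz) (# none) t f eq
        (trans (cong (λ k → # xy * (k * # yz)) (trans (sym (∣cls∣ xz)) e)) (*-zeroʳ (# xy)))
  ... | _ | _ | inj₁ e = core-arith-empty (# xy) (# xz) (# yz) (# none) t f eq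
        (trans (cong (λ k → # xy * (# xz * k)) (trans (sym (∣cls∣ yz)) e))
          (trans (cong (# xy *_) (*-zeroʳ (# xz))) (*-zeroʳ (# xy))))
  ... | inj₂ (u , hu) | inj₂ (v , hv) | inj₂ (w , hw) =
    core-arith (# xy) (# xz) (# yz) (# none) t f eq (subst (λ s → 6 * products (# xy) (# xz) (# yz) * s ≤
      8 * # none * products (# xy) (# xz) (# yz) + 3 * f * s) eq
      (combine (# xy) (# xz) (# yz) (# none) f
        (subst (λ b → 3 * (# xy + b) * (# xy * b) ≤ 4 * # none * (# xy * b) + f * (# xy + b)) (two xz yz tt)
          (split ix iy iz xy (xz ∪ yz) oz (ox ∪ oy) tt tt tt tt tt tt tt))
        (subst (λ b → 3 * (# xz + b) * (# xz * b) ≤ 4 * # none * (# xz * b) + f * (# xz + b)) (two xy yz tt)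
          (split ix iy iz xz (xy ∪ yz) oy (ox ∪ oz) tt tt tt tt tt tt tt))
        (subst (λ b → 3 * (# yz + b) * (# yz * b) ≤ 4 * # none * (# yz * b) + f * (# yz + b)) (two xy xz tt)
          (split ix iy iz yz (xy ∪ xz) ox (oy ∪ oz) tt tt tt tt tt tt tt))))
    where
    iz : Independent G r z
    iz = let ru , k = ∧-T {r u} hu
             ab , _ = ∧-T {adj G x u ∧ adj G y u} k
             a , b = ∧-T {adj G x u} ab in sz u ru a b
    iy : Independent G r y
    iy = let ru , k = ∧-T {r v} hv
             ab , _ = ∧-T {adj G x v ∧ adj G z v} k
             a , b = ∧-T {adj G x v} ab in sy v ru a b
    ix : Independent G r x
    ix = let ru , k = ∧-T {r w} hw
             ab , _ = ∧-T {adj G y w ∧ adj G z w} k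
             a , b = ∧-T {adj G y w} ab in sx w ru a b
    two : ∀ κ ξ → T (agree (ind (κ ∪ ξ) ∷ []) (ind κ ∷ ind ξ ∷ [])) → # (κ ∪ ξ) ≡ # κ + # ξ
    two κ ξ h = trans (sym (+-identityʳ _)) (trans (weights-agree (ind (κ ∪ ξ) ∷ []) (ind κ ∷ ind ξ ∷ []) h)
      (cong (# κ +_) (+-identityʳ _)))
    -- Each time the two parts add up to α + β + γ, and their products add up to 2(αβ + βγ + γα).
    combine : ∀ α β γ z f →
      3 * (α + (β + γ)) * (α * (β + γ)) ≤ 4 * z * (α * (β + γ)) + f * (α + (β + γ)) →
      3 * (β + (α + γ)) * (β * (α + γ)) ≤ 4 * z * (β * (α + γ)) + f * (β + (α + γ)) →
      3 * (γ + (α + β)) * (γ * (α + β)) ≤ 4 * z * (γ * (α + β)) + f * (γ + (α + β)) →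
      6 * products α β γ * (α + β + γ) ≤ 8 * z * products α β γ + 3 * f * (α + β + γ)
    combine α β γ z f h₁ h₂ h₃ = subst₂ _≤_ (l α β γ) (l′ α β γ z f) (+-mono-≤ (+-mono-≤ h₁ h₂) h₃)
      where
      l : ∀ α β γ → 3 * (α + (β + γ)) * (α * (β + γ)) + 3 * (β + (α + γ)) * (β * (α + γ)) + 3 * (γ + (α + β)) * (γ * (α + β)) ≡
          6 * (α * β + β * γ + γ * α) * (α + β + γ)
      l = solve-∀
      l′ : ∀ α β γ z f → 4 * z * (α * (β + γ)) + f * (α + (β + γ)) + (4 * z * (β * (α + γ)) + f * (β + (α + γ))) +
           (4 * z * (γ * (α + β)) + f * (γ + (α + β))) ≡ 8 * z * (α * β + β * γ + γ * α) + 3 * f * (α + β + γ)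
      l′ = solve-∀

  -- Holds type by type: as degree 3 cannot occur, the degree exceeds 1 by one exactly for the types
  -- with two neighbours, and falls short by one exactly for `none`.
  degree-sum : weight deg + # none ≡ S + ∣ r ∣
  degree-sum = trans (l (weight deg) (# none)) (trans (weights-agree (deg ∷ ind none ∷ []) (ind xy ∷ ind xz ∷ ind yz ∷ (λ _ _ _ → 1) ∷ []) tt)
    (trans (l′ (# xy) (# xz) (# yz) _) (cong (S +_) (sym ∣r∣))))
    where
    l : ∀ a b → a + b ≡ a + (b + 0)
    l = solve-∀
    l′ : ∀ a b c d → a + (b + (c + (d + 0))) ≡ a + b + c + d
    l′ = solve-∀

-- Packings of triangles

Triple : ℕ → Set
Triple n = Fin n × Fin n × Fin n

Σ-mono-∈ : ∀ {A : Set} (xs : List A) {f g : A → ℕ} → (∀ {x} → x ∈ xs → f x ≤ g x) → Σ xs f ≤ Σ xs g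
Σ-mono-∈ []       h = z≤n
Σ-mono-∈ (x ∷ xs) h = +-mono-≤ (h (here refl)) (Σ-mono-∈ xs (h ∘ there))

above-average : ∀ {A : Set} (g : A → ℕ) x xs → ∃ λ t → t ∈ (x ∷ xs) × Σ (x ∷ xs) g ≤ length (x ∷ xs) * g t
above-average g x []       = x , here refl , ≤-refl
above-average g x (y ∷ ys) with above-average g y ys
... | t , t∈ , h with ≤-total (g x) (g t)
...   | inj₁ gx≤gt = t , there t∈ , +-mono-≤ gx≤gt h
...   | inj₂ gt≤gx = x , here refl , +-monoʳ-≤ (g x) (≤-trans h (*-monoʳ-≤ (length (y ∷ ys)) gt≤gx))

onTriple : ∀ {n} → (Fin n → ℕ) → Triple n → ℕ
onTriple f (x , y , z) = f x + f y + f z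

outside : ∀ {n} → List (Triple n) → Mask n
outside []                 v = true
outside ((x , y , z) ∷ ts) v = (not (does (v ≟ x)) ∧ (not (does (v ≟ y)) ∧ not (does (v ≟ z)))) ∧ outside ts v

module _ {n} {x y z v : Fin n} {ts : List (Triple n)} where

  outside⁺ : v ≢ x → v ≢ y → v ≢ z → T (outside ts v) → T (outside ((x , y , z) ∷ ts) v)
  outside⁺ a b c h rewrite dec-false (v ≟ x) a | dec-false (v ≟ y) b | dec-false (v ≟ z) c = h

  outside⁻ : T (outside ((x , y , z) ∷ ts) v) → v ≢ x × v ≢ y × v ≢ z × T (outside ts v)
  outside⁻ h with v ≟ x | v ≟ y | v ≟ z
  ... | no a | no b | no c = a , b , c , h

∈⇒≢ : ∀ {n} {x y z v : Fin n} {ts} → (x , y , z) ∈ ts → T (outside ts v) → v ≢ x × v ≢ y × v ≢ z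
∈⇒≢ {v = v} {ts = (a , b , c) ∷ ts} (here refl) h = let p , q , s , _ = outside⁻ {ts = ts} h in p , q , s
∈⇒≢ {v = v} {ts = (a , b , c) ∷ ts} (there m)   h = ∈⇒≢ m (proj₂ (proj₂ (proj₂ (outside⁻ {ts = ts} h))))

module _ {n} (G : Graph n) where

  adj⇒≢ : ∀ {u v} → T (adj G u v) → u ≢ v
  adj⇒≢ {u} h refl = subst T (irrefl G u) h

  IsTriangle : Fin n → Fin n → Fin n → Set
  IsTriangle x y z = T (adj G x y) × T (adj G x z) × T (adj G y z)

  data Packing : List (Triple n) → Set where
    []  : Packing []
    add : ∀ {x y z ts} → IsTriangle x y z → T (outside ts x) → T (outside ts y) → T (outside ts z) →
          Packing ts → Packing ((x , y , z) ∷ ts)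

  packing-∈ : ∀ {x y z ts} → Packing ts → (x , y , z) ∈ ts → IsTriangle x y z
  packing-∈ (add t _ _ _ _) (here refl) = t
  packing-∈ (add _ _ _ _ p) (there m)   = packing-∈ p m

  ∑-outside : ∀ {ts} → Packing ts → ∀ f → ∑ f ≡ ∑ (λ v → ⟦ outside ts v ⟧ * f v) + Σ ts (onTriple f)
  ∑-outside []                             f = trans (Σ-cong (allFin n) (λ v → sym (*-identityˡ (f v)))) (sym (+-identityʳ _))
  ∑-outside {t ∷ ts} (add {x} {y} {z} (xy , xz , yz) ox oy oz p) f = begin
    ∑ f
      ≡⟨ ∑-outside p f ⟩
    ∑ (λ v → ⟦ outside ts v ⟧ * f v) + Σ ts (onTriple f)
      ≡⟨ cong (_+ Σ ts (onTriple f)) (begin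
        ∑ (λ v → ⟦ outside ts v ⟧ * f v)
          ≡⟨ Σ-cong (allFin n) (λ v → trans (cong (_* f v) (indicator v)) (dist (δ x v) (δ y v) (δ z v) _ (f v))) ⟩
        ∑ (λ v → δ x v * f v + (δ y v * f v + (δ z v * f v + ⟦ outside (t ∷ ts) v ⟧ * f v)))
          ≡⟨ trans (Σ-+ (allFin n) _ _) (cong₂ _+_ (∑-δ x f) (trans (Σ-+ (allFin n) _ _) (cong₂ _+_ (∑-δ y f)
               (trans (Σ-+ (allFin n) _ _) (cong (_+ rest) (∑-δ z f)))))) ⟩
        f x + (f y + (f z + rest)) ∎) ⟩
    f x + (f y + (f z + rest)) + Σ ts (onTriple f)
      ≡⟨ shuffle (f x) (f y) (f z) rest (Σ ts (onTriple f)) ⟩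
    rest + Σ (t ∷ ts) (onTriple f) ∎
    where
    open ≡-Reasoning
    rest = ∑ (λ v → ⟦ outside (t ∷ ts) v ⟧ * f v)
    dist : ∀ a b c d e → (a + (b + (c + d))) * e ≡ a * e + (b * e + (c * e + d * e))
    dist = solve-∀
    shuffle : ∀ a b c d e → a + (b + (c + d)) + e ≡ d + (a + b + c + e)
    shuffle = solve-∀
    indicator : ∀ v → ⟦ outside ts v ⟧ ≡ δ x v + (δ y v + (δ z v + ⟦ outside (t ∷ ts) v ⟧))
    indicator v with v ≟ x | v ≟ y | v ≟ z
    ... | yes refl | yes refl | _        = ⊥-elim (adj⇒≢ xy refl)
    ... | yes refl | no _     | yes refl = ⊥-elim (adj⇒≢ xz refl)
    ... | yes refl | no _     | no _     = T⇒⟦⟧≡1 ox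
    ... | no _     | yes refl | yes refl = ⊥-elim (adj⇒≢ yz refl)
    ... | no _     | yes refl | no _     = T⇒⟦⟧≡1 oy
    ... | no _     | no _     | yes refl = T⇒⟦⟧≡1 oz
    ... | no _     | no _     | no _     = refl

  -- Prepares an exchange: once the triangle is taken out, its three vertices are available again
  -- and nothing that was available is lost.
  remove : ∀ {x y z ts} → Packing ts → (x , y , z) ∈ ts → ∃ λ us → Packing us × length ts ≡ suc (length us) ×
           (∀ v → T (outside ts v) → T (outside us v)) × T (outside us x) × T (outside us y) × T (outside us z)
  remove {ts = t ∷ ts} (add tri ox oy oz p) (here refl) =
    ts , p , refl , (λ v h → proj₂ (proj₂ (proj₂ (outside⁻ {ts = ts} h)))) , ox , oy , oz
  remove {ts = (a , b , c) ∷ ts} (add tri oa ob oc p) (there m)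
    with us , q , len , sub , ox , oy , oz ← remove p m
    with a≢x , a≢y , a≢z ← ∈⇒≢ m oa | b≢x , b≢y , b≢z ← ∈⇒≢ m ob | c≢x , c≢y , c≢z ← ∈⇒≢ m oc =
    (a , b , c) ∷ us , add tri (sub a oa) (sub b ob) (sub c oc) q , cong suc len ,
    (λ v h → let p₁ , p₂ , p₃ , h′ = outside⁻ {ts = ts} h in outside⁺ {ts = us} p₁ p₂ p₃ (sub v h′)) ,
    outside⁺ {ts = us} (≢-sym a≢x) (≢-sym b≢x) (≢-sym c≢x) ox ,
    outside⁺ {ts = us} (≢-sym a≢y) (≢-sym b≢y) (≢-sym c≢y) oy ,
    outside⁺ {ts = us} (≢-sym a≢z) (≢-sym b≢z) (≢-sym c≢z) oz

  Optimal : List (Triple n) → Set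
  Optimal ts = TriangleFree G (outside ts) × (∀ {x y z} → (x , y , z) ∈ ts →
    Unswappable G (outside ts) x y z × Unswappable G (outside ts) x z y × Unswappable G (outside ts) y z x)

  Larger : List (Triple n) → Set
  Larger ts = ∃ λ us → Packing us × length us ≡ suc (length ts)

  module _ (free : K4Free G) where

    module _ {ts} (p : Packing ts) where

      private r = outside ts

      -- u is to replace o, while v and w are to form a new triangle with o. All conditions sit in
      -- one Boolean so that the search is decidable.
      Swappable : Fin n → Fin n → Fin n → Set
      Swappable a b o = ∃ λ u → ∃ λ v → ∃ λ w →
        T ((r u ∧ (adj G a u ∧ adj G b u)) ∧ ((r v ∧ r w) ∧ (adj G o v ∧ (adj G o w ∧ adj G v w))))

      swappable? : ∀ a b o → Dec (Swappable a b o)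
      swappable? a b o = any? λ u → any? λ v → any? λ w → T? _

      ¬swappable⇒ : ∀ {a b o} → ¬ Swappable a b o → Unswappable G r a b o
      ¬swappable⇒ h u ru au bu v w rv rw ov ow vw =
        h (u , v , w , T-∧⁺ (T-∧⁺ ru (T-∧⁺ au bu)) (T-∧⁺ (T-∧⁺ rv rw) (T-∧⁺ ov (T-∧⁺ ow vw))))

      swap : ∀ {a b o us} → IsTriangle a b o → Packing us → length ts ≡ suc (length us) →
             (∀ v → T (r v) → T (outside us v)) → T (outside us a) → T (outside us b) → T (outside us o) →
             (∀ v → T (r v) → v ≢ a × v ≢ b × v ≢ o) → Swappable a b o → Larger ts
      swap {a} {b} {o} {us} (ab , ao , bo) q len sub oa ob oo new (u , v , w , h)
        with h₁ , h₂ ← ∧-T {r u ∧ (adj G a u ∧ adj G b u)} h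
        with ru , h₃ ← ∧-T {r u} h₁
        with au , bu ← ∧-T {adj G a u} h₃
        with h₄ , h₅ ← ∧-T {r v ∧ r w} h₂
        with rv , rw ← ∧-T {r v} h₄
        with ov , h₆ ← ∧-T {adj G o v} h₅
        with ow , vw ← ∧-T {adj G o w} h₆
        with u≢a , u≢b , u≢o ← new u ru | v≢a , v≢b , v≢o ← new v rv | w≢a , w≢b , w≢o ← new w rw =
        (a , b , u) ∷ (o , v , w) ∷ us ,
        add (ab , au , bu)
          (outside⁺ {ts = us} (adj⇒≢ ao) (≢-sym v≢a) (≢-sym w≢a) oa)
          (outside⁺ {ts = us} (adj⇒≢ bo) (≢-sym v≢b) (≢-sym w≢b) ob)
          (outside⁺ {ts = us} u≢o (λ { refl → ¬ou ov }) (λ { refl → ¬ou ow }) (sub u ru))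
          (add (ov , ow , vw) oo (sub v rv) (sub w rw) q) ,
        cong suc (sym len)
        where
        -- Keeps the two new triangles disjoint: v and w are adjacent to o, whereas u, being
        -- adjacent to a and b, cannot be.
        ¬ou : ¬ T (adj G o u)
        ¬ou ou = free a b o u ab ao au bo bu ou

      Bad : Triple n → Set
      Bad (x , y , z) = Swappable x y z ⊎ Swappable x z y ⊎ Swappable y z x

      bad? : ∀ t → Dec (Bad t)
      bad? (x , y , z) = swappable? x y z ⊎-dec (swappable? x z y ⊎-dec swappable? y z x)

      bad⇒larger : ∀ {t} → t ∈ ts → Bad t → Larger ts
      bad⇒larger {x , y , z} m bad
        with us , q , len , sub , ox , oy , oz ← remove p m
        with xy , xz , yz ← packing-∈ p m
        with bad
      ... | inj₁ s        = swap (xy , xz , yz) q len sub ox oy oz (λ v → ∈⇒≢ m) s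
      ... | inj₂ (inj₁ s) = swap (xz , xy , adj-sym G yz) q len sub ox oz oy
                              (λ v h → let a , b , c = ∈⇒≢ m h in a , c , b) s
      ... | inj₂ (inj₂ s) = swap (yz , adj-sym G xy , adj-sym G xz) q len sub oy oz ox
                              (λ v h → let a , b , c = ∈⇒≢ m h in b , c , a) s

      enlarge : Larger ts ⊎ Optimal ts
      enlarge with any? (λ u → any? λ v → any? λ w → T? ((r u ∧ (r v ∧ r w)) ∧ (adj G u v ∧ (adj G u w ∧ adj G v w))))
      ... | yes (u , v , w , h) =
        let h₁ , h₂ = ∧-T {r u ∧ (r v ∧ r w)} h
            ru , h₃ = ∧-T {r u} h₁
            rv , rw = ∧-T {r v} h₃
            uv , h₄ = ∧-T {adj G u v} h₂
            uw , vw = ∧-T {adj G u w} h₄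
        in inj₁ ((u , v , w) ∷ ts , add (uv , uw , vw) ru rv rw p , refl)
      ... | no none with Any.any? bad? ts
      ...   | yes b = let t , m , bad = find b in inj₁ (bad⇒larger m bad)
      ...   | no ¬b = inj₂
        ( (λ u v w ru rv rw uv uw vw → none (u , v , w , T-∧⁺ (T-∧⁺ ru (T-∧⁺ rv rw)) (T-∧⁺ uv (T-∧⁺ uw vw))))
        , (λ m → ¬swappable⇒ (λ s → ¬b (lose m (inj₁ s)))
               , ¬swappable⇒ (λ s → ¬b (lose m (inj₂ (inj₁ s))))
               , ¬swappable⇒ (λ s → ¬b (lose m (inj₂ (inj₂ s))))) )

    packing-size : ∀ {ts} → Packing ts → n ≡ ∣ outside ts ∣ + length ts * 3
    packing-size {ts} p = begin
      n                                                          ≡⟨ ∑-1 n ⟨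
      ∑ {n} (λ _ → 1)                                            ≡⟨ ∑-outside p (λ _ → 1) ⟩
      ∑ (λ v → ⟦ outside ts v ⟧ * 1) + Σ ts (onTriple (λ _ → 1)) ≡⟨ cong₂ _+_ (Σ-cong (allFin n) (λ v → *-identityʳ ⟦ outside ts v ⟧)) (Σ-const ts 3) ⟩
      ∣ outside ts ∣ + length ts * 3                             ∎
      where open ≡-Reasoning

    -- Every enlargement adds one triangle, and a packing has at most n/3 of them, so the invariant
    -- becomes absurd when `fuel` runs out.
    optimal : ∀ fuel {ts} → Packing ts → n < length ts + fuel → ∃ λ us → Packing us × Optimal us
    optimal zero {ts} p n< = ⊥-elim (<-irrefl refl (begin-strict
      n                                <⟨ n< ⟩
      length ts + 0                    ≡⟨ +-identityʳ (length ts) ⟩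
      length ts                        ≤⟨ m≤m*n (length ts) 3 ⟩
      length ts * 3                    ≤⟨ m≤n+m _ _ ⟩
      ∣ outside ts ∣ + length ts * 3   ≡⟨ packing-size p ⟨
      n                                ∎))
      where open ≤-Reasoning
    optimal (suc fuel) {ts} p n< with enlarge p
    ... | inj₂ o = ts , p , o
    ... | inj₁ (us , q , len) = optimal fuel q (subst (n <_) (trans (+-suc (length ts) fuel) (cong (_+ fuel) (sym len))) n<)

-- The lower bound

deg≤2 : ∀ a b c → (T a → T b → T c → ⊥) → deg a b c ≤ 2
deg≤2 true  true  true  h = ⊥-elim (h tt tt tt)
deg≤2 true  true  false h = ≤-refl
deg≤2 false b     c     h = +-mono-≤ (⟦⟧≤1 b) (⟦⟧≤1 c)
deg≤2 true  false c     h = +-monoʳ-≤ 1 (⟦⟧≤1 c)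

-- `s₁`, `s₂`, `s₃` will be the saturation indicators for the vertices to which `a`, `b`, `c` refer.
-- A degree of 2 is paid for by the indicator of the remaining vertex.
deg≤1+ : ∀ a b c s₁ s₂ s₃ → (T a → T b → T c → ⊥) → (T b → T c → s₁ ≡ 1) → (T a → T c → s₂ ≡ 1) → (T a → T b → s₃ ≡ 1) →
         deg a b c ≤ 1 + (s₁ + s₂ + s₃)
deg≤1+ true  true  true  s₁ s₂ s₃ h _ _ _ = ⊥-elim (h tt tt tt)
deg≤1+ true  true  false s₁ s₂ s₃ h _ _ k rewrite k tt tt = s≤s (m≤n+m 1 (s₁ + s₂))
deg≤1+ true  false true  s₁ s₂ s₃ h _ k _ rewrite k tt tt = s≤s (≤-trans (m≤n+m 1 s₁) (m≤m+n _ s₃))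
deg≤1+ false true  true  s₁ s₂ s₃ h k _ _ rewrite k tt tt = s≤s (s≤s z≤n)
deg≤1+ true  false false s₁ s₂ s₃ h _ _ _ = s≤s z≤n
deg≤1+ false true  false s₁ s₂ s₃ h _ _ _ = s≤s z≤n
deg≤1+ false false c     s₁ s₂ s₃ h _ _ _ = ≤-trans (⟦⟧≤1 c) (s≤s z≤n)

module _ {n} (G : Graph n) where

  private V = allFin n

  adj# sat# : Fin n → Fin n → ℕ
  adj# u v = ⟦ adj G u v ⟧
  sat# u v = ⟦ saturating G u v ⟧

  toTriple : (Fin n → Fin n → ℕ) → Triple n → Fin n → ℕ
  toTriple F (x , y , z) v = F x v + F y v + F z v

  inner : Mask n → (Fin n → Fin n → ℕ) → ℕ
  inner r F = ∑ (λ u → ∑ (λ v → (⟦ r u ⟧ * ⟦ r v ⟧) * F u v))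

  crossing within : List (Triple n) → (Fin n → Fin n → ℕ) → ℕ
  crossing ts F = Σ ts (λ t → ∑ (λ v → ⟦ outside ts v ⟧ * toTriple F t v))
  within   ts F = Σ ts (λ t → Σ ts (onTriple (toTriple F t)))

  -- Stated for any symmetric F, since adjacency and saturation are both split in this way.
  decompose : ∀ {ts} → Packing G ts → ∀ F → (∀ u v → F u v ≡ F v u) →
              ∑ (λ u → ∑ (F u)) ≡ inner (outside ts) F + 2 * crossing ts F + within ts F
  decompose {ts} p F F-sym = begin
    ∑ (λ u → ∑ (F u))
      ≡⟨ ∑-outside G p (λ u → ∑ (F u)) ⟩
    ∑ (λ u → R u * ∑ (F u)) + Σ ts (onTriple (λ u → ∑ (F u)))
      ≡⟨ cong₂ _+_ rows columns ⟩
    (inner r F + crossing ts F) + (crossing ts F + within ts F)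
      ≡⟨ lem (inner r F) (crossing ts F) (within ts F) ⟩
    inner r F + 2 * crossing ts F + within ts F ∎
    where
    open ≡-Reasoning
    r = outside ts
    R : Fin n → ℕ
    R v = ⟦ r v ⟧
    lem : ∀ a b c → (a + b) + (b + c) ≡ a + 2 * b + c
    lem = solve-∀
    columns : Σ ts (onTriple (λ u → ∑ (F u))) ≡ crossing ts F + within ts F
    columns = begin
      Σ ts (onTriple (λ u → ∑ (F u)))
        ≡⟨ Σ-cong ts (λ { (x , y , z) → trans (cong (_+ ∑ (F z)) (sym (Σ-+ V (F x) (F y)))) (sym (Σ-+ V _ (F z))) }) ⟩
      Σ ts (λ t → ∑ (toTriple F t))
        ≡⟨ Σ-cong ts (λ t → ∑-outside G p (toTriple F t)) ⟩
      Σ ts (λ t → ∑ (λ v → R v * toTriple F t v) + Σ ts (onTriple (toTriple F t)))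
        ≡⟨ Σ-+ ts _ _ ⟩
      crossing ts F + within ts F ∎
    rows : ∑ (λ u → R u * ∑ (F u)) ≡ inner r F + crossing ts F
    rows = begin
      ∑ (λ u → R u * ∑ (F u))
        ≡⟨ Σ-cong V (λ u → cong (R u *_) (∑-outside G p (F u))) ⟩
      ∑ (λ u → R u * (∑ (λ v → R v * F u v) + Σ ts (onTriple (F u))))
        ≡⟨ Σ-cong V (λ u → trans (*-distribˡ-+ (R u) _ _) (cong₂ _+_
             (trans (sym (Σ-*ˡ (R u) V _)) (Σ-cong V (λ v → sym (*-assoc (R u) (R v) (F u v)))))
             (sym (Σ-*ˡ (R u) ts _)))) ⟩
      ∑ (λ u → ∑ (λ v → (R u * R v) * F u v) + Σ ts (λ t → R u * onTriple (F u) t))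
        ≡⟨ Σ-+ V _ _ ⟩
      inner r F + ∑ (λ u → Σ ts (λ t → R u * onTriple (F u) t))
        ≡⟨ cong (inner r F +_) (trans (Σ-swap V ts _) (Σ-cong ts (λ { (x , y , z) → Σ-cong V (λ u →
             cong (R u *_) (cong₂ _+_ (cong₂ _+_ (F-sym u x) (F-sym u y)) (F-sym u z))) }))) ⟩
      inner r F + crossing ts F ∎

  inner-∧ : ∀ r (b : Fin n → Fin n → Bool) → inner r (λ u v → ⟦ b u v ⟧) ≡ ∑ (λ u → ∑ (λ v → ⟦ (r u ∧ r v) ∧ b u v ⟧))
  inner-∧ r b = Σ-cong V (λ u → Σ-cong V (λ v →
    sym (trans (⟦⟧-∧ (r u ∧ r v) (b u v)) (cong (_* ⟦ b u v ⟧) (⟦⟧-∧ (r u) (r v))))))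

  module _ (free : K4Free G) where

    module _ {x y z} (tri : IsTriangle G x y z) where

      private
        xy-adj = proj₁ tri
        xz-adj = proj₁ (proj₂ tri)
        yz-adj = proj₂ (proj₂ tri)

      sat-intro : ∀ {p q u v} → T (adj G p q) → T (adj G p u) → T (adj G q u) → T (adj G p v) → T (adj G q v) →
                  sat# u v ≡ 1
      sat-intro {p} {q} {u} {v} a b c d e = T⇒⟦⟧≡1 (common-edge⇒sat G free a b c d e)

      not-all : ∀ v → T (adj G x v) → T (adj G y v) → T (adj G z v) → ⊥
      not-all v a b c = free x y z v xy-adj xz-adj a yz-adj b c

      triple-degree≤2 : ∀ v → toTriple adj# (x , y , z) v ≤ 2
      triple-degree≤2 v = deg≤2 (adj G x v) (adj G y v) (adj G z v) (not-all v)

      -- This includes v = x: its two neighbours y and z are adjacent, so `saturating` holds at (x,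
      -- x). Hence the count within the packing treats a triangle paired with itself like any other
      -- pair.
      triple-degree≤1+sat : ∀ v → toTriple adj# (x , y , z) v ≤ 1 + toTriple sat# (x , y , z) v
      triple-degree≤1+sat v = deg≤1+ (adj G x v) (adj G y v) (adj G z v) _ _ _ (not-all v)
        (sat-intro yz-adj (adj-sym G xy-adj) (adj-sym G xz-adj))
        (sat-intro xz-adj xy-adj (adj-sym G yz-adj))
        (sat-intro xy-adj xz-adj yz-adj)

    -- The hypothesis is that there are more than n²/4 edges. By Mantel's theorem the packing is
    -- then nonempty, so that a best triangle exists.
    sat-lower : n * n < 2 * ∑ (λ u → ∑ (adj# u)) → 4 * (n * n) ≤ 33 * ∑ (λ u → ∑ (sat# u))
    sat-lower h with optimal G free (suc n) [] ≤-refl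
    ... | [] , p , tf , _ = ⊥-elim (<-irrefl refl (begin-strict
      n * n                          <⟨ h ⟩
      2 * ∑ (λ u → ∑ (adj# u))       ≤⟨ mantel G (λ _ → true) tf ⟩
      ∑ {n} (λ _ → 1) * ∑ {n} (λ _ → 1)      ≡⟨ cong (λ m → m * m) (∑-1 n) ⟩
      n * n                          ∎))
      where open ≤-Reasoning
    ... | ts@(t₀ ∷ ts₀) , p , tf , unswappable
      with (x , y , z) , t∈ , best ← above-average (λ t → ∑ (λ v → ⟦ outside ts v ⟧ * toTriple adj# t v)) t₀ ts₀
      with tri@(x-y , x-z , y-z) ← packing-∈ G p t∈
      with sz , sy , sx ← unswappable t∈ =
      subst (λ N → 4 * (N * N) ≤ 33 * ∑ (λ u → ∑ (sat# u))) (sym size)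
        (final-arith m k (arcs G r) (crossing ts adj#) (within ts adj#) (crossing ts sat#) (within ts sat#)
          (squares (# xy) (# xz) (# yz)) (∑ (λ u → ∑ (sat# u))) (weight deg) S (# none) f
          (s≤s z≤n) deficiency edge-count within≤ crossing≤ within≤sat best degree-sum sat-count (core sz sy sx))
      where
      open ≤-Reasoning
      r = outside ts
      k = length ts
      m = ∣ r ∣
      open Triangle G free r tf x y z x-y x-z y-z
      size : n ≡ m + 3 * k
      size = trans (packing-size G free p) (cong (m +_) (*-comm k 3))
      edge-count : (m + 3 * k) * (m + 3 * k) ≤ 2 * (arcs G r + 2 * crossing ts adj# + within ts adj#)
      edge-count = begin
        (m + 3 * k) * (m + 3 * k)    ≡⟨ cong (λ N → N * N) size ⟨
        n * n                        ≤⟨ <⇒≤ h ⟩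
        2 * ∑ (λ u → ∑ (adj# u))     ≡⟨ cong (2 *_) (decompose p adj# (λ u v → cong ⟦_⟧ (Graph.sym G u v))) ⟩
        2 * (inner r adj# + 2 * crossing ts adj# + within ts adj#)
          ≡⟨ cong (λ a → 2 * (a + 2 * crossing ts adj# + within ts adj#)) (inner-∧ r (adj G)) ⟩
        2 * (arcs G r + 2 * crossing ts adj# + within ts adj#) ∎
      within≤ : within ts adj# ≤ 6 * (k * k)
      within≤ = begin
        within ts adj#
          ≤⟨ Σ-mono-∈ ts (λ { {t} t∈ → Σ-mono ts (λ { (a , b , c) →
               +-mono-≤ (+-mono-≤ (triple-degree≤2 (packing-∈ G p t∈) a) (triple-degree≤2 (packing-∈ G p t∈) b)) (triple-degree≤2 (packing-∈ G p t∈) c) }) }) ⟩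
        Σ ts (λ _ → Σ ts (λ _ → 6))   ≡⟨ trans (Σ-const ts _) (cong (k *_) (Σ-const ts 6)) ⟩
        k * (k * 6)                   ≡⟨ lem k ⟩
        6 * (k * k) ∎
        where lem : ∀ k → k * (k * 6) ≡ 6 * (k * k)
              lem = solve-∀
      within≤sat : within ts adj# ≤ 3 * (k * k) + within ts sat#
      within≤sat = begin
        within ts adj#
          ≤⟨ Σ-mono-∈ ts (λ { {t} t∈ → Σ-mono ts (λ { (a , b , c) → ≤-trans
               (+-mono-≤ (+-mono-≤ (triple-degree≤1+sat (packing-∈ G p t∈) a) (triple-degree≤1+sat (packing-∈ G p t∈) b)) (triple-degree≤1+sat (packing-∈ G p t∈) c))
               (≤-reflexive (lem₁ (toTriple sat# t a) (toTriple sat# t b) (toTriple sat# t c))) }) }) ⟩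
        Σ ts (λ t → Σ ts (λ t′ → 3 + onTriple (toTriple sat# t) t′))
          ≡⟨ Σ-cong ts (λ t → trans (Σ-+ ts (λ _ → 3) (onTriple (toTriple sat# t))) (cong (_+ Σ ts (onTriple (toTriple sat# t))) (Σ-const ts 3))) ⟩
        Σ ts (λ t → k * 3 + Σ ts (onTriple (toTriple sat# t)))
          ≡⟨ trans (Σ-+ ts (λ _ → k * 3) (λ t → Σ ts (onTriple (toTriple sat# t)))) (cong (_+ within ts sat#) (Σ-const ts (k * 3))) ⟩
        k * (k * 3) + within ts sat#  ≡⟨ cong (_+ within ts sat#) (lem k) ⟩
        3 * (k * k) + within ts sat# ∎
        where lem : ∀ k → k * (k * 3) ≡ 3 * (k * k)
              lem = solve-∀
              lem₁ : ∀ a b c → (1 + a) + (1 + b) + (1 + c) ≡ 3 + (a + b + c)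
              lem₁ = solve-∀
      crossing≤ : crossing ts adj# ≤ k * m + crossing ts sat#
      crossing≤ = begin
        crossing ts adj#
          ≤⟨ Σ-mono-∈ ts (λ { {t} t∈ → Σ-mono V (λ v → ≤-trans (*-monoʳ-≤ ⟦ r v ⟧ (triple-degree≤1+sat (packing-∈ G p t∈) v))
               (≤-reflexive (*-suc ⟦ r v ⟧ (toTriple sat# t v)))) }) ⟩
        Σ ts (λ t → ∑ (λ v → ⟦ r v ⟧ + ⟦ r v ⟧ * toTriple sat# t v))
          ≡⟨ Σ-cong ts (λ t → Σ-+ V (λ v → ⟦ r v ⟧) (λ v → ⟦ r v ⟧ * toTriple sat# t v)) ⟩
        Σ ts (λ t → m + ∑ (λ v → ⟦ r v ⟧ * toTriple sat# t v))
          ≡⟨ trans (Σ-+ ts (λ _ → m) (λ t → ∑ (λ v → ⟦ r v ⟧ * toTriple sat# t v))) (cong (_+ crossing ts sat#) (Σ-const ts m)) ⟩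
        k * m + crossing ts sat# ∎
      sat-count : squares (# xy) (# xz) (# yz) + 2 * crossing ts sat# + within ts sat# ≤ ∑ (λ u → ∑ (sat# u))
      sat-count = begin
        squares (# xy) (# xz) (# yz) + 2 * crossing ts sat# + within ts sat#
          ≤⟨ +-monoˡ-≤ _ (+-monoˡ-≤ _ (≤-trans squares≤sat (≤-reflexive (sym (inner-∧ r (saturating G)))))) ⟩
        inner r sat# + 2 * crossing ts sat# + within ts sat#
          ≡⟨ decompose p sat# (λ u v → cong ⟦_⟧ (saturating-sym G free u v)) ⟨
        ∑ (λ u → ∑ (sat# u)) ∎

-- Counting unordered pairs

<ᵇ-true : ∀ {a b} → a < b → (a <ᵇ b) ≡ true
<ᵇ-true {a} {b} a<b with a <ᵇ b | <⇒<ᵇ a<b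
... | true | _ = refl

<ᵇ-false : ∀ {a b} → ¬ a < b → (a <ᵇ b) ≡ false
<ᵇ-false {a} {b} h with a <ᵇ b in eq
... | false = refl
... | true  = ⊥-elim (h (<ᵇ⇒< a b (subst T (sym eq) tt)))

module _ {n : ℕ} where

  private V = allFin n

  before : Fin n → Fin n → ℕ
  before i j = ⟦ toℕ i <ᵇ toℕ j ⟧

  countPairs : (Fin n → Fin n → Bool) → ℕ
  countPairs b = length (filter (λ p → T? (b (proj₁ p) (proj₂ p))) (pairs n))

  countPairs≡ : ∀ b → countPairs b ≡ ∑ (λ i → ∑ (λ j → before i j * ⟦ b i j ⟧))
  countPairs≡ b = trans (length-filter-Σ (λ p → T? (b (proj₁ p) (proj₂ p))) (pairs n))
    (trans (Σ-filter (λ p → T? (toℕ (proj₁ p) <ᵇ toℕ (proj₂ p))) (concatMap (λ i → map (λ j → (i , j)) V) V) _)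
    (trans (Σ-concatMap (λ i → map (λ j → (i , j)) V) V _)
    (Σ-cong V (λ i → Σ-map (λ j → (i , j)) V _))))

  trichotomy : ∀ i j → before i j + before j i + δ i j ≡ 1
  trichotomy i j with <-cmp (toℕ i) (toℕ j)
  ... | tri< a ¬b _ rewrite <ᵇ-true a | <ᵇ-false (<⇒≯ a) with j ≟ i
  ...   | yes refl = ⊥-elim (¬b refl)
  ...   | no _ = refl
  trichotomy i j | tri≈ _ b _ with refl ← toℕ-injective b with j ≟ j
  ...   | yes _ rewrite <ᵇ-false (<-irrefl {toℕ j} refl) = refl
  ...   | no ¬e = ⊥-elim (¬e refl)
  trichotomy i j | tri> _ ¬b c rewrite <ᵇ-true c | <ᵇ-false (<⇒≯ c) with j ≟ i
  ...   | yes refl = ⊥-elim (¬b refl)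
  ...   | no _ = refl

  symmetric-sum : ∀ b → (∀ i j → b i j ≡ b j i) →
                  ∑ (λ i → ∑ (λ j → ⟦ b i j ⟧)) ≡ 2 * countPairs b + ∑ (λ i → ⟦ b i i ⟧)
  symmetric-sum b b-sym = begin
    ∑ (λ i → ∑ (λ j → ⟦ b i j ⟧))
      ≡⟨ Σ-cong V (λ i → Σ-cong V (λ j → trans (sym (*-identityˡ ⟦ b i j ⟧)) (trans (cong (_* ⟦ b i j ⟧) (sym (trichotomy i j)))
           (lem (before i j) (before j i) (δ i j) ⟦ b i j ⟧)))) ⟩
    ∑ (λ i → ∑ (λ j → up i j + (down i j + δ i j * ⟦ b i j ⟧)))
      ≡⟨ Σ-cong V (λ i → trans (Σ-+ V (up i) _) (cong (∑ (up i) +_) (trans (Σ-+ V (down i) _) (cong (∑ (down i) +_) (∑-δ i (λ j → ⟦ b i j ⟧)))))) ⟩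
    ∑ (λ i → ∑ (up i) + (∑ (down i) + ⟦ b i i ⟧))
      ≡⟨ trans (Σ-+ V _ _) (cong (∑ (λ i → ∑ (up i)) +_) (Σ-+ V _ _)) ⟩
    ∑ (λ i → ∑ (up i)) + (∑ (λ i → ∑ (down i)) + diag)
      ≡⟨ cong₂ (λ x y → x + (y + diag)) (sym (countPairs≡ b)) (trans (Σ-swap V V down)
           (trans (Σ-cong V (λ j → Σ-cong V (λ i → cong (λ x → before j i * ⟦ x ⟧) (b-sym i j)))) (sym (countPairs≡ b)))) ⟩
    countPairs b + (countPairs b + diag)
      ≡⟨ lem₂ (countPairs b) diag ⟩
    2 * countPairs b + diag ∎
    where
    open ≡-Reasoning
    up down : Fin n → Fin n → ℕ
    up i j = before i j * ⟦ b i j ⟧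
    down i j = before j i * ⟦ b i j ⟧
    diag = ∑ (λ i → ⟦ b i i ⟧)
    lem : ∀ p q d x → (p + q + d) * x ≡ p * x + (q * x + d * x)
    lem = solve-∀
    lem₂ : ∀ c d → c + (c + d) ≡ 2 * c + d
    lem₂ = solve-∀

-- The extremal construction

-- The construction refers to vertices by number, and sums over initial segments of ℕ are easily cut
-- into blocks.
sumTo : ℕ → (ℕ → ℕ) → ℕ
sumTo zero    f = 0
sumTo (suc n) f = sumTo n f + f n

sumTo-cong : ∀ n {f g} → (∀ {i} → i < n → f i ≡ g i) → sumTo n f ≡ sumTo n g
sumTo-cong zero    h = refl
sumTo-cong (suc n) h = cong₂ _+_ (sumTo-cong n (h ∘ m<n⇒m<1+n)) (h ≤-refl)

sumTo-mono : ∀ n {f g} → (∀ i → f i ≤ g i) → sumTo n f ≤ sumTo n g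
sumTo-mono zero    h = z≤n
sumTo-mono (suc n) h = +-mono-≤ (sumTo-mono n h) (h n)

sumTo-const : ∀ n c → sumTo n (λ _ → c) ≡ n * c
sumTo-const zero    c = refl
sumTo-const (suc n) c = trans (cong (_+ c) (sumTo-const n c)) (+-comm (n * c) c)

sumTo-zero : ∀ n {f} → (∀ {i} → i < n → f i ≡ 0) → sumTo n f ≡ 0
sumTo-zero n h = trans (sumTo-cong n h) (trans (sumTo-const n 0) (*-zeroʳ n))

sumTo-+ : ∀ n f g → sumTo n (λ i → f i + g i) ≡ sumTo n f + sumTo n g
sumTo-+ zero    f g = refl
sumTo-+ (suc n) f g = trans (cong (_+ (f n + g n)) (sumTo-+ n f g)) (lem (sumTo n f) (sumTo n g) (f n) (g n))
  where lem : ∀ a b c d → a + b + (c + d) ≡ a + c + (b + d)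
        lem = solve-∀

sumTo-split : ∀ m n f → sumTo (m + n) f ≡ sumTo m f + sumTo n (λ i → f (m + i))
sumTo-split m zero    f = trans (cong (λ k → sumTo k f) (+-identityʳ m)) (sym (+-identityʳ _))
sumTo-split m (suc n) f = trans (cong (λ k → sumTo k f) (+-suc m n))
  (trans (cong (_+ f (m + n)) (sumTo-split m n f)) (+-assoc (sumTo m f) _ _))

sumTo-blocks : ∀ k c f → sumTo (k * c) f ≡ sumTo k (λ p → sumTo c (λ i → f (p * c + i)))
sumTo-blocks zero    c f = refl
sumTo-blocks (suc k) c f = trans (cong (λ m → sumTo m f) (+-comm c (k * c)))
  (trans (sumTo-split (k * c) c f) (cong (_+ sumTo c (λ i → f (k * c + i))) (sumTo-blocks k c f)))

sumTo-below : ∀ {m n} → m ≤ n → ∀ f → sumTo n (λ i → ⟦ i <ᵇ m ⟧ * f i) ≡ sumTo m f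
sumTo-below {m} m≤n f with d , refl ← m≤n⇒∃[o]m+o≡n m≤n = begin
  sumTo (m + d) (λ i → ⟦ i <ᵇ m ⟧ * f i)
    ≡⟨ sumTo-split m d _ ⟩
  sumTo m (λ i → ⟦ i <ᵇ m ⟧ * f i) + sumTo d (λ i → ⟦ m + i <ᵇ m ⟧ * f (m + i))
    ≡⟨ cong₂ _+_
         (sumTo-cong m (λ {i} i<m → trans (cong (λ b → ⟦ b ⟧ * f i) (<ᵇ-true i<m)) (+-identityʳ (f i))))
         (sumTo-zero d (λ {i} _ → cong (λ b → ⟦ b ⟧ * f (m + i)) (<ᵇ-false (m+n≮m m i)))) ⟩
  sumTo m f + 0
    ≡⟨ +-identityʳ _ ⟩
  sumTo m f ∎
  where open ≡-Reasoning

sumTo-below-1 : ∀ {m n} → m ≤ n → sumTo n (λ i → ⟦ i <ᵇ m ⟧) ≡ m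
sumTo-below-1 {m} {n} m≤n = trans (sumTo-cong n (λ {i} _ → sym (*-identityʳ ⟦ i <ᵇ m ⟧)))
  (trans (sumTo-below m≤n (λ _ → 1)) (trans (sumTo-const m 1) (*-identityʳ m)))

sumTo-head : ∀ n f → sumTo (suc n) f ≡ f 0 + sumTo n (f ∘ suc)
sumTo-head zero    f = +-comm 0 (f 0)
sumTo-head (suc n) f = trans (cong (_+ f (suc n)) (sumTo-head n f)) (+-assoc (f 0) _ _)

∑-sumTo : ∀ n (f : ℕ → ℕ) → ∑ {n} (f ∘ toℕ) ≡ sumTo n f
∑-sumTo zero    f = refl
∑-sumTo (suc n) f = begin
  ∑ {suc n} (f ∘ toℕ)           ≡⟨ ∑-suc {n} (f ∘ toℕ) ⟩
  f 0 + ∑ {n} (f ∘ suc ∘ toℕ)   ≡⟨ cong (f 0 +_) (∑-sumTo n (f ∘ suc)) ⟩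
  f 0 + sumTo n (f ∘ suc)       ≡⟨ sumTo-head n f ⟨
  sumTo (suc n) f               ∎
  where open ≡-Reasoning

-- Parity and the balanced complete bipartite graph.

even : ℕ → Bool
even zero    = true
even (suc n) = not (even n)

crossParity : ℕ → ℕ
crossParity p = sumTo p (λ q → ⟦ even q xor even p ⟧)

-- Each q < p differs in parity from exactly one of p and p + 1, and p itself differs from p + 1.
crossParity-consecutive : ∀ p → crossParity p + crossParity (suc p) ≡ suc p
crossParity-consecutive p = begin
  crossParity p + (sumTo p (λ q → ⟦ even q xor not (even p) ⟧) + ⟦ even p xor not (even p) ⟧)
    ≡⟨ +-assoc (crossParity p) _ _ ⟨
  crossParity p + sumTo p (λ q → ⟦ even q xor not (even p) ⟧) + ⟦ even p xor not (even p) ⟧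
    ≡⟨ cong₂ _+_ (sym (sumTo-+ p _ _)) (xor-not (even p)) ⟩
  sumTo p (λ q → ⟦ even q xor even p ⟧ + ⟦ even q xor not (even p) ⟧) + 1
    ≡⟨ cong (_+ 1) (trans (sumTo-cong p (λ {q} _ → one (even q) (even p))) (trans (sumTo-const p 1) (*-identityʳ p))) ⟩
  p + 1
    ≡⟨ +-comm p 1 ⟩
  suc p ∎
  where
  open ≡-Reasoning
  xor-not : ∀ b → ⟦ b xor not b ⟧ ≡ 1
  xor-not true  = refl
  xor-not false = refl
  one : ∀ a b → ⟦ a xor b ⟧ + ⟦ a xor not b ⟧ ≡ 1
  one true  true  = refl
  one true  false = refl
  one false true  = refl
  one false false = refl

-- The number of edges of the complete bipartite graph between the even and the odd numbers below N,
-- each counted at its larger end; its value is ⌊N²/4⌋.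
balanced : ℕ → ℕ
balanced N = sumTo N crossParity

balanced-bounds : ∀ N → 4 * balanced N ≤ N * N × N * N ≤ 4 * balanced N + 1
balanced-bounds zero          = z≤n , z≤n
balanced-bounds (suc zero)    = z≤n , s≤s z≤n
balanced-bounds (suc (suc N)) with lo , hi ← balanced-bounds N = (begin
  4 * balanced (2 + N)             ≡⟨ step ⟩
  4 * balanced N + (4 * N + 4)     ≤⟨ +-monoˡ-≤ (4 * N + 4) lo ⟩
  N * N + (4 * N + 4)              ≡⟨ sq N ⟩
  (2 + N) * (2 + N)                ∎) , (begin
  (2 + N) * (2 + N)                ≡⟨ sq N ⟨
  N * N + (4 * N + 4)              ≤⟨ +-monoˡ-≤ (4 * N + 4) hi ⟩
  4 * balanced N + 1 + (4 * N + 4) ≡⟨ lem (4 * balanced N) (4 * N + 4) ⟩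
  4 * balanced N + (4 * N + 4) + 1 ≡⟨ cong (_+ 1) step ⟨
  4 * balanced (2 + N) + 1         ∎)
  where
  open ≤-Reasoning
  sq : ∀ N → N * N + (4 * N + 4) ≡ (2 + N) * (2 + N)
  sq = solve-∀
  lem : ∀ a b → a + 1 + b ≡ a + b + 1
  lem = solve-∀
  step : 4 * balanced (2 + N) ≡ 4 * balanced N + (4 * N + 4)
  step = trans (cong (4 *_) (trans (+-assoc (balanced N) _ _) (cong (balanced N +_) (crossParity-consecutive N)))) (lem₂ (balanced N) N)
    where lem₂ : ∀ b N → 4 * (b + suc N) ≡ 4 * b + (4 * N + 4)
          lem₂ = solve-∀

-- The graph will be properly 3-coloured, with C in colour 0. The first fact excludes K₄ and gives
-- the ends of a saturating pair equal colours; the second puts a vertex of C into every triangle.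
-- Both are decided by enumeration.
ThirdColour ColourZero : Set
ThirdColour = ∀ (a b x y : Fin 3) → a ≢ b → a ≢ x → b ≢ x → a ≢ y → b ≢ y → x ≡ y
ColourZero  = ∀ (a b x : Fin 3) → a ≢ b → a ≢ x → b ≢ x → a ≡ 0F ⊎ b ≡ 0F ⊎ x ≡ 0F

thirdColour? : Dec ThirdColour
thirdColour? = all? λ a → all? λ b → all? λ x → all? λ y →
  ¬? (a ≟ b) →-dec (¬? (a ≟ x) →-dec (¬? (b ≟ x) →-dec (¬? (a ≟ y) →-dec (¬? (b ≟ y) →-dec (x ≟ y)))))

colourZero? : Dec ColourZero
colourZero? = all? λ a → all? λ b → all? λ x →
  ¬? (a ≟ b) →-dec (¬? (a ≟ x) →-dec (¬? (b ≟ x) →-dec ((a ≟ 0F) ⊎-dec ((b ≟ 0F) ⊎-dec (x ≟ 0F)))))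

third-colour : ThirdColour
third-colour = toWitness {a? = thirdColour?} tt

colour-zero : ColourZero
colour-zero = toWitness {a? = colourZero?} tt

-- Vertices below c form the independent set C; vertex c + p has position p, and positions
-- of different parity are adjacent.  The M edges between C and the rest are laid out
-- lexicographically by position, so that only the first ⌈M / c⌉ positions meet C.
module Construction (c M : ℕ) where

  near : ℕ → ℕ → Bool
  near i p = p * c + i <ᵇ M

  link : ℕ → ℕ → Bool
  link a b = if a <ᵇ c then (if b <ᵇ c then false else near a (b ∸ c))
                       else (if b <ᵇ c then near b (a ∸ c) else (even (a ∸ c) xor even (b ∸ c)))

  link-sym : ∀ a b → link a b ≡ link b a
  link-sym a b with a <ᵇ c | b <ᵇ c
  ... | true  | true  = refl
  ... | true  | false = refl
  ... | false | true  = refl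
  ... | false | false = xor-comm (even (a ∸ c)) (even (b ∸ c))

  link-irrefl : ∀ a → link a a ≡ false
  link-irrefl a with a <ᵇ c
  ... | true  = refl
  ... | false = xor-same (even (a ∸ c))

  graph : ∀ n → Graph n
  graph n = record
    { adj    = λ i j → link (toℕ i) (toℕ j)
    ; sym    = λ i j → link-sym (toℕ i) (toℕ j)
    ; irrefl = λ i → link-irrefl (toℕ i) }

  colour : ℕ → Fin 3
  colour a = if a <ᵇ c then 0F else if even (a ∸ c) then 1F else 2F

  link⇒colour≢ : ∀ a b → T (link a b) → colour a ≢ colour b
  link⇒colour≢ a b h e with a <ᵇ c | b <ᵇ c
  ... | true  | true  = h
  ... | true  | false with even (b ∸ c)
  ...   | true with () ← e
  ...   | false with () ← e
  link⇒colour≢ a b h e | false | true with even (a ∸ c)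
  ...   | true with () ← e
  ...   | false with () ← e
  link⇒colour≢ a b h e | false | false with even (a ∸ c) | even (b ∸ c)
  ...   | true  | true  = h
  ...   | false | false = h
  ...   | true  | false with () ← e
  ...   | false | true  with () ← e

  inC : ℕ → Bool
  inC a = a <ᵇ c

  -- The vertices of one side that may have neighbours in C: if position p has any, then p · c < M.
  touches : Bool → ℕ → Bool
  touches b a = (not (a <ᵇ c) ∧ not (even (a ∸ c) xor b)) ∧ ((a ∸ c) * c <ᵇ M)

  colour≡0⇒link⇒near : ∀ i a → colour i ≡ 0F → colour a ≢ 0F → T (link i a) → T ((a ∸ c) * c <ᵇ M)
  colour≡0⇒link⇒near i a e ne h with i <ᵇ c | a <ᵇ c
  ... | true  | true  = ⊥-elim h
  ... | true  | false = <⇒<ᵇ (≤-<-trans (m≤m+n ((a ∸ c) * c) i) (<ᵇ⇒< ((a ∸ c) * c + i) M h))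
  ... | false | _ with even (i ∸ c)
  ...   | true with () ← e
  ...   | false with () ← e

  colour-touches : ∀ a b → colour a ≡ colour b → colour a ≢ 0F →
    T ((a ∸ c) * c <ᵇ M) → T ((b ∸ c) * c <ᵇ M) → (T (touches true a) × T (touches true b)) ⊎ (T (touches false a) × T (touches false b))
  colour-touches a b e ne h k with a <ᵇ c | b <ᵇ c
  ... | true  | _     = ⊥-elim (ne refl)
  ... | false | true  = ⊥-elim (ne e)
  ... | false | false with even (a ∸ c) | even (b ∸ c)
  ...   | true  | true  = inj₁ (h , k)
  ...   | false | false = inj₂ (h , k)
  ...   | true  | false with () ← e
  ...   | false | true  with () ← e

  colour-inC : ∀ a → colour a ≡ 0F → T (inC a)
  colour-inC a e with a <ᵇ c
  ... | true = tt
  ... | false with even (a ∸ c)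
  ...   | true with () ← e
  ...   | false with () ← e

  module _ (n : ℕ) where

    private
      G = graph n
      V = allFin n
      κ : Fin n → Fin 3
      κ v = colour (toℕ v)

    proper : ∀ {u v} → T (adj G u v) → κ u ≢ κ v
    proper {u} {v} = link⇒colour≢ (toℕ u) (toℕ v)

    graph-free : K4Free G
    graph-free a b x y ab ax ay bx by xy =
      proper {x} {y} xy (third-colour (κ a) (κ b) (κ x) (κ y) (proper {a} {b} ab) (proper {a} {x} ax) (proper {b} {x} bx) (proper {a} {y} ay) (proper {b} {y} by))

    Confined : Fin n → Fin n → Set
    Confined u v = (T (inC (toℕ u)) × T (inC (toℕ v))) ⊎
      (T (touches true (toℕ u)) × T (touches true (toℕ v))) ⊎ (T (touches false (toℕ u)) × T (touches false (toℕ v)))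

    confined-via : ∀ {i u v} → κ i ≡ 0F → κ u ≡ κ v → κ u ≢ 0F → T (adj G i u) → T (adj G i v) → Confined u v
    confined-via {i} {u} {v} e κu≡κv ne iu iv = inj₂ (colour-touches (toℕ u) (toℕ v) κu≡κv ne
      (colour≡0⇒link⇒near (toℕ i) (toℕ u) e ne iu)
      (colour≡0⇒link⇒near (toℕ i) (toℕ v) e (ne ∘ trans κu≡κv) iv))

    -- Both u and v complete pq to a triangle, so they have the same colour, and one of p, q, u lies
    -- in C. If u does, so does v; otherwise p or q is a common neighbour of u and v in C.
    common-edge-confined : ∀ {p q u v} → T (adj G p q) → T (adj G p u) → T (adj G q u) → T (adj G p v) → T (adj G q v) →
                           Confined u v
    common-edge-confined {p} {q} {u} {v} pq pu qu pv qv = go (κ u ≟ 0F)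
      where
      κu≡κv : κ u ≡ κ v
      κu≡κv = third-colour (κ p) (κ q) (κ u) (κ v) (proper {p} {q} pq) (proper {p} {u} pu) (proper {q} {u} qu) (proper {p} {v} pv) (proper {q} {v} qv)
      side : κ u ≢ 0F → κ p ≡ 0F ⊎ κ q ≡ 0F ⊎ κ u ≡ 0F → Confined u v
      side ne (inj₁ e)        = confined-via {p} {u} {v} e κu≡κv ne pu pv
      side ne (inj₂ (inj₁ e)) = confined-via {q} {u} {v} e κu≡κv ne qu qv
      side ne (inj₂ (inj₂ e)) = ⊥-elim (ne e)
      go : Dec (κ u ≡ 0F) → Confined u v
      go (yes e) = inj₁ (colour-inC (toℕ u) e , colour-inC (toℕ v) (trans (sym κu≡κv) e))
      go (no ne) = side ne (colour-zero (κ p) (κ q) (κ u) (proper {p} {q} pq) (proper {p} {u} pu) (proper {q} {u} qu))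

    sat-confined : ∀ {u v} → T (saturating G u v) → Confined u v
    sat-confined h = let p , q , pq , pu , qu , pv , qv = sat⇒common-edge G h in
      common-edge-confined {p} {q} pq pu qu pv qv

module _ (c N M : ℕ) where

  open Construction c M

  private
    n = c + N
    V = allFin n
    G = graph n

  link-C-C : ∀ {a b} → a < c → b < c → link a b ≡ false
  link-C-C a<c b<c rewrite <ᵇ-true a<c | <ᵇ-true b<c = refl

  link-C-position : ∀ {a} p → a < c → link a (c + p) ≡ near a p
  link-C-position {a} p a<c rewrite <ᵇ-true a<c | <ᵇ-false (m+n≮m c p) | m+n∸m≡n c p = refl

  link-positions : ∀ q p → link (c + q) (c + p) ≡ even q xor even p
  link-positions q p rewrite <ᵇ-false (m+n≮m c q) | <ᵇ-false (m+n≮m c p) | m+n∸m≡n c q | m+n∸m≡n c p = refl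

  -- Each edge is counted at its later end. The pairs of position p with C carry the numbers from p
  -- · c up to p · c + c - 1, so over all positions these blocks fill the numbers below N · c, of
  -- which M are edges.
  edges-graph : M ≤ N * c → edges G ≡ M + balanced N
  edges-graph M≤Nc = begin
    edges G
      ≡⟨ countPairs≡ (adj G) ⟩
    ∑ (λ i → ∑ (λ j → before i j * ⟦ adj G i j ⟧))
      ≡⟨ Σ-swap V V (λ i j → before i j * ⟦ adj G i j ⟧) ⟩
    ∑ {n} (λ j → ∑ {n} (λ i → ⟦ toℕ i <ᵇ toℕ j ⟧ * ⟦ link (toℕ i) (toℕ j) ⟧))
      ≡⟨ Σ-cong V (λ j → trans (∑-sumTo n (λ i → ⟦ i <ᵇ toℕ j ⟧ * ⟦ link i (toℕ j) ⟧))
           (sumTo-below (<⇒≤ (toℕ<n j)) (λ i → ⟦ link i (toℕ j) ⟧))) ⟩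
    ∑ {n} (λ j → back (toℕ j))
      ≡⟨ ∑-sumTo n back ⟩
    sumTo (c + N) back
      ≡⟨ sumTo-split c N back ⟩
    sumTo c back + sumTo N (λ p → back (c + p))
      ≡⟨ cong₂ _+_ (sumTo-zero c (λ {j} j<c → sumTo-zero j (λ {i} i<j → cong ⟦_⟧ (link-C-C (<-trans i<j j<c) j<c))))
           (sumTo-cong N (λ {p} _ → trans (sumTo-split c p (λ i → ⟦ link i (c + p) ⟧))
             (cong₂ _+_ (sumTo-cong c (λ {i} i<c → cong ⟦_⟧ (link-C-position p i<c)))
                        (sumTo-cong p (λ {q} _ → cong ⟦_⟧ (link-positions q p)))))) ⟩
    sumTo N (λ p → sumTo c (λ i → ⟦ p * c + i <ᵇ M ⟧) + crossParity p)
      ≡⟨ sumTo-+ N _ crossParity ⟩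
    sumTo N (λ p → sumTo c (λ i → ⟦ p * c + i <ᵇ M ⟧)) + balanced N
      ≡⟨ cong (_+ balanced N) (trans (sym (sumTo-blocks N c (λ i → ⟦ i <ᵇ M ⟧))) (sumTo-below-1 M≤Nc)) ⟩
    M + balanced N ∎
    where
    open ≡-Reasoning
    back : ℕ → ℕ
    back j = sumTo j (λ i → ⟦ link i j ⟧)

  module _ (L : ℕ) (L≤N : L ≤ N) (M≤Lc : M ≤ L * c) where

    parityCount : Bool → ℕ → ℕ
    parityCount b k = sumTo k (λ p → ⟦ not (even p xor b) ⟧)

    parityCount-bound : ∀ b k → 2 * parityCount b k ≤ 1 + k
    parityCount-bound b zero          = z≤n
    parityCount-bound true  (suc zero) = ≤-refl
    parityCount-bound false (suc zero) = z≤n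
    parityCount-bound b (suc (suc k)) = begin
      2 * (parityCount b k + ⟦ not (even k xor b) ⟧ + ⟦ not (not (even k) xor b) ⟧)
        ≡⟨ cong (2 *_) (trans (+-assoc (parityCount b k) _ _) (cong (parityCount b k +_) (one (even k) b))) ⟩
      2 * (parityCount b k + 1)     ≡⟨ *-distribˡ-+ 2 (parityCount b k) 1 ⟩
      2 * parityCount b k + 2       ≤⟨ +-monoˡ-≤ 2 (parityCount-bound b k) ⟩
      1 + k + 2                     ≡⟨ +-comm (1 + k) 2 ⟩
      1 + (2 + k)                   ∎
      where
      open ≤-Reasoning
      one : ∀ a b → ⟦ not (a xor b) ⟧ + ⟦ not (not a xor b) ⟧ ≡ 1
      one true  true  = refl
      one true  false = refl
      one false true  = refl
      one false false = refl

    maskC : Mask n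
    maskC v = inC (toℕ v)

    maskT : Bool → Mask n
    maskT b v = touches b (toℕ v)

    ∣maskC∣ : ∣ maskC ∣ ≡ c
    ∣maskC∣ = trans (∑-sumTo n (λ a → ⟦ a <ᵇ c ⟧)) (sumTo-below-1 (m≤m+n c N))

    touches-C : ∀ b {a} → a < c → touches b a ≡ false
    touches-C b a<c rewrite <ᵇ-true a<c = refl

    touches-position : ∀ b p → ⟦ touches b (c + p) ⟧ ≤ ⟦ p <ᵇ L ⟧ * ⟦ not (even p xor b) ⟧
    touches-position b p rewrite <ᵇ-false (m+n≮m c p) | m+n∸m≡n c p = ⟦⟧-bound _ λ h →
      let e , l = ∧-T {not (even p xor b)} h in
      ≤-reflexive (sym (cong₂ _*_ (cong ⟦_⟧ (<ᵇ-true (*-cancelʳ-< c p L (<-≤-trans (<ᵇ⇒< (p * c) M l) M≤Lc)))) (T⇒⟦⟧≡1 e)))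

    ∣maskT∣ : ∀ b → 2 * ∣ maskT b ∣ ≤ 1 + L
    ∣maskT∣ b = begin
      2 * ∣ maskT b ∣
        ≡⟨ cong (2 *_) (trans (∑-sumTo n (λ a → ⟦ touches b a ⟧)) (sumTo-split c N (λ a → ⟦ touches b a ⟧))) ⟩
      2 * (sumTo c (λ a → ⟦ touches b a ⟧) + sumTo N (λ p → ⟦ touches b (c + p) ⟧))
        ≤⟨ *-monoʳ-≤ 2 (+-mono-≤ (≤-reflexive (sumTo-zero c (λ a<c → cong ⟦_⟧ (touches-C b a<c)))) (sumTo-mono N (touches-position b))) ⟩
      2 * sumTo N (λ p → ⟦ p <ᵇ L ⟧ * ⟦ not (even p xor b) ⟧)
        ≡⟨ cong (2 *_) (sumTo-below L≤N (λ p → ⟦ not (even p xor b) ⟧)) ⟩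
      2 * parityCount b L
        ≤⟨ parityCount-bound b L ⟩
      1 + L ∎
      where open ≤-Reasoning

    -- Saturating pairs lie inside C or inside one side of the first L positions, and each side has
    -- at most (1 + L)/2 of these. Ordered pairs are counted, which doubles `satCount`.
    satCount-graph : 4 * satCount G ≤ 2 * (c * c) + (1 + L) * (1 + L)
    satCount-graph = *-cancelˡ-≤ 2 (begin
      2 * (4 * satCount G)
        ≡⟨ lem (satCount G) ⟩
      4 * (2 * satCount G)
        ≤⟨ *-monoʳ-≤ 4 (m≤m+n (2 * satCount G) _) ⟩
      4 * (2 * satCount G + ∑ (λ v → ⟦ saturating G v v ⟧))
        ≡⟨ cong (4 *_) (symmetric-sum (saturating G) (saturating-sym G (graph-free n))) ⟨
      4 * ∑ (λ u → ∑ (λ v → ⟦ saturating G u v ⟧))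
        ≤⟨ *-monoʳ-≤ 4 (Σ-mono V (λ u → Σ-mono V (λ v → ⟦⟧-bound (saturating G u v) (point u v ∘ sat-confined n)))) ⟩
      4 * ∑ (λ u → ∑ (λ v → ⟦ maskC u ⟧ * ⟦ maskC v ⟧ + (⟦ maskT true u ⟧ * ⟦ maskT true v ⟧ + ⟦ maskT false u ⟧ * ⟦ maskT false v ⟧)))
        ≡⟨ cong (4 *_) (trans (ΣΣ-+ V V _ _) (cong₂ _+_ (square maskC) (trans (ΣΣ-+ V V _ _) (cong₂ _+_ (square (maskT true)) (square (maskT false)))))) ⟩
      4 * (∣ maskC ∣ * ∣ maskC ∣ + (a * a + b * b))
        ≡⟨ cong (λ x → 4 * (x * x + (a * a + b * b))) ∣maskC∣ ⟩
      4 * (c * c + (a * a + b * b))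
        ≡⟨ lem₂ (c * c) a b ⟩
      4 * (c * c) + ((2 * a) * (2 * a) + (2 * b) * (2 * b))
        ≤⟨ +-monoʳ-≤ (4 * (c * c)) (+-mono-≤ (*-mono-≤ (∣maskT∣ true) (∣maskT∣ true)) (*-mono-≤ (∣maskT∣ false) (∣maskT∣ false))) ⟩
      4 * (c * c) + ((1 + L) * (1 + L) + (1 + L) * (1 + L))
        ≡⟨ lem₃ (c * c) ((1 + L) * (1 + L)) ⟩
      2 * (2 * (c * c) + (1 + L) * (1 + L)) ∎)
      where
      open ≤-Reasoning
      a = ∣ maskT true ∣
      b = ∣ maskT false ∣
      lem : ∀ s → 2 * (4 * s) ≡ 4 * (2 * s)
      lem = solve-∀
      lem₂ : ∀ d a b → 4 * (d + (a * a + b * b)) ≡ 4 * d + ((2 * a) * (2 * a) + (2 * b) * (2 * b))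
      lem₂ = solve-∀
      lem₃ : ∀ d l → 4 * d + (l + l) ≡ 2 * (2 * d + l)
      lem₃ = solve-∀
      square : ∀ (p : Mask n) → ∑ (λ u → ∑ (λ v → ⟦ p u ⟧ * ⟦ p v ⟧)) ≡ ∣ p ∣ * ∣ p ∣
      square p = ΣΣ-* V V (λ u → ⟦ p u ⟧) (λ v → ⟦ p v ⟧)
      product≡1 : ∀ {x y} → T x → T y → 1 ≡ ⟦ x ⟧ * ⟦ y ⟧
      product≡1 hx hy = sym (cong₂ _*_ (T⇒⟦⟧≡1 hx) (T⇒⟦⟧≡1 hy))
      point : ∀ u v → Confined n u v →
              1 ≤ ⟦ maskC u ⟧ * ⟦ maskC v ⟧ + (⟦ maskT true u ⟧ * ⟦ maskT true v ⟧ + ⟦ maskT false u ⟧ * ⟦ maskT false v ⟧)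
      point u v (inj₁ (h , k)) = ≤-trans (≤-reflexive (product≡1 h k)) (m≤m+n _ _)
      point u v (inj₂ (inj₁ (h , k))) = ≤-trans (≤-reflexive (product≡1 h k)) (≤-trans (m≤m+n _ _) (m≤n+m _ (⟦ maskC u ⟧ * ⟦ maskC v ⟧)))
      point u v (inj₂ (inj₂ (h , k))) = ≤-trans (≤-reflexive (product≡1 h k)) (≤-trans (m≤n+m _ (⟦ maskT true u ⟧ * ⟦ maskT true v ⟧)) (m≤n+m _ (⟦ maskC u ⟧ * ⟦ maskC v ⟧)))

-- Choice of the parameters of the construction.

n²≤3+4⌊n²∕4⌋ : ∀ n → n * n ≤ 3 + 4 * (n * n / 4)
n²≤3+4⌊n²∕4⌋ n = begin
  n * n                            ≡⟨ m≡m%n+[m/n]*n (n * n) 4 ⟩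
  n * n % 4 + n * n / 4 * 4        ≤⟨ +-mono-≤ (≤-pred (m%n<n (n * n) 4)) (≤-reflexive (*-comm (n * n / 4) 4)) ⟩
  3 + 4 * (n * n / 4)              ∎
  where open ≤-Reasoning

-- The bipartite graph on N = n - c vertices lacks about (n² - N²)/4 = c(2N + c)/4 edges. At c edges
-- per position they occupy about (2n - c)/4 positions, half of them on each side; c = ⌊2n/33⌋
-- balances the pairs inside C against those inside the two sides.
sparse-graph : ∀ n → 73 ≤ n → ∃ λ (G : Graph n) → K4Free G × edges G ≡ n * n / 4 + 1 × 33 * satCount G ≤ 2 * (n * n) + 33 * n
sparse-graph n 73≤n = subst (λ k → ∃ λ (G : Graph k) → K4Free G × edges G ≡ k * k / 4 + 1 × 33 * satCount G ≤ 2 * (k * k) + 33 * k) c+N≡n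
  ( graph (c + N) , graph-free (c + N)
  , trans (edges-graph c N M (≤-trans M≤Lc (*-monoˡ-≤ c L≤N))) (m∸n+n≡m B≤q+1)
  , bound )
  where
  open ≤-Reasoning
  c = 2 * n / 33
  c*33≤2n : c * 33 ≤ 2 * n
  c*33≤2n = m/n*n≤m (2 * n) 33
  2n≤ : 2 * n ≤ 32 + c * 33
  2n≤ = begin
    2 * n                      ≡⟨ m≡m%n+[m/n]*n (2 * n) 33 ⟩
    2 * n % 33 + c * 33        ≤⟨ +-monoˡ-≤ (c * 33) (≤-pred (m%n<n (2 * n) 33)) ⟩
    32 + c * 33                ∎
  c≤n : c ≤ n
  c≤n = *-cancelʳ-≤ c n 33 (≤-trans c*33≤2n (≤-trans (*-monoˡ-≤ n {2} {33} (s≤s (s≤s z≤n))) (≤-reflexive (*-comm 33 n))))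
  N = n ∸ c
  c+N≡n : c + N ≡ n
  c+N≡n = m+[n∸m]≡n c≤n
  1≤c : 1 ≤ c
  1≤c = *-cancelʳ-< 33 0 c (+-cancelˡ-< 32 0 (c * 33) (begin-strict
    32             <⟨ m≤m+n 33 113 ⟩
    2 * 73         ≤⟨ *-monoʳ-≤ 2 73≤n ⟩
    2 * n          ≤⟨ 2n≤ ⟩
    32 + c * 33    ∎))
  k = c + N
  q = k * k / 4
  B = balanced N
  M = q + 1 ∸ B
  open Construction c M
  N≤k : N ≤ k
  N≤k = m≤n+m N c
  B≤q+1 : B ≤ q + 1
  B≤q+1 = *-cancelˡ-≤ 4 (begin
    4 * B          ≤⟨ proj₁ (balanced-bounds N) ⟩
    N * N          ≤⟨ *-mono-≤ N≤k N≤k ⟩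
    k * k          ≤⟨ n²≤3+4⌊n²∕4⌋ k ⟩
    3 + 4 * q      ≤⟨ n≤1+n _ ⟩
    4 + 4 * q      ≡⟨ lem q ⟩
    4 * (q + 1)    ∎)
    where lem : ∀ q → 4 + 4 * q ≡ 4 * (q + 1)
          lem = solve-∀
  4M≤ : 4 * M ≤ c * (2 * N + c) + 5
  4M≤ = +-cancelʳ-≤ (N * N) _ _ (begin
    4 * M + N * N                    ≤⟨ +-monoʳ-≤ (4 * M) (proj₂ (balanced-bounds N)) ⟩
    4 * M + (4 * B + 1)              ≡⟨ lem M B ⟩
    4 * (M + B) + 1                  ≡⟨ cong (λ x → 4 * x + 1) (m∸n+n≡m B≤q+1) ⟩
    4 * (q + 1) + 1                  ≡⟨ lem₂ q ⟩
    q * 4 + 5                        ≤⟨ +-monoˡ-≤ 5 (m/n*n≤m (k * k) 4) ⟩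
    (c + N) * (c + N) + 5            ≡⟨ lem₃ c N ⟩
    c * (2 * N + c) + 5 + N * N      ∎)
    where
    lem : ∀ M B → 4 * M + (4 * B + 1) ≡ 4 * (M + B) + 1
    lem = solve-∀
    lem₂ : ∀ q → 4 * (q + 1) + 1 ≡ q * 4 + 5
    lem₂ = solve-∀
    lem₃ : ∀ c N → (c + N) * (c + N) + 5 ≡ c * (2 * N + c) + 5 + N * N
    lem₃ = solve-∀
  -- Positions from L on are not joined to C.
  L = (2 * N + c + 8) / 4
  4L≤ : L * 4 ≤ 2 * N + c + 8
  4L≤ = m/n*n≤m (2 * N + c + 8) 4
  -- This explains 8 = 5 + 3: the division loses at most 3, and the remaining 5 absorbs the constant
  -- in `4M≤`, because c ≥ 1.
  ≤4L : 2 * N + c + 5 ≤ L * 4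
  ≤4L = +-cancelʳ-≤ 3 _ _ (begin
    2 * N + c + 5 + 3                      ≡⟨ +-assoc (2 * N + c) 5 3 ⟩
    2 * N + c + 8                          ≡⟨ m≡m%n+[m/n]*n (2 * N + c + 8) 4 ⟩
    (2 * N + c + 8) % 4 + L * 4            ≤⟨ +-monoˡ-≤ (L * 4) (≤-pred (m%n<n (2 * N + c + 8) 4)) ⟩
    3 + L * 4                              ≡⟨ +-comm 3 (L * 4) ⟩
    L * 4 + 3                              ∎)
  M≤Lc : M ≤ L * c
  M≤Lc = *-cancelˡ-≤ 4 (begin
    4 * M                              ≤⟨ 4M≤ ⟩
    c * (2 * N + c) + 5                ≤⟨ +-monoʳ-≤ (c * (2 * N + c)) (*-monoˡ-≤ 5 1≤c) ⟩
    c * (2 * N + c) + c * 5            ≡⟨ *-distribˡ-+ c (2 * N + c) 5 ⟨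
    c * (2 * N + c + 5)                ≤⟨ *-monoʳ-≤ c ≤4L ⟩
    c * (L * 4)                        ≡⟨ lem c L ⟩
    4 * (L * c)                        ∎)
    where lem : ∀ c L → c * (L * 4) ≡ 4 * (L * c)
          lem = solve-∀
  c*31≤2N : c * 31 ≤ 2 * N
  c*31≤2N = +-cancelˡ-≤ (2 * c) _ _ (begin
    2 * c + c * 31     ≡⟨ lem c ⟩
    c * 33             ≤⟨ c*33≤2n ⟩
    2 * n              ≡⟨ cong (2 *_) c+N≡n ⟨
    2 * (c + N)        ≡⟨ *-distribˡ-+ 2 c N ⟩
    2 * c + 2 * N      ∎)
    where lem : ∀ c → 2 * c + c * 31 ≡ c * 33
          lem = solve-∀
  L≤N : L ≤ N
  L≤N = *-cancelʳ-≤ L N 4 (begin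
    L * 4                    ≤⟨ 4L≤ ⟩
    2 * N + c + 8            ≤⟨ +-monoʳ-≤ (2 * N + c) (≤-trans (m≤m+n 8 22) (*-monoˡ-≤ 30 1≤c)) ⟩
    2 * N + c + c * 30       ≡⟨ lem N c ⟩
    2 * N + c * 31           ≤⟨ +-monoʳ-≤ (2 * N) c*31≤2N ⟩
    2 * N + 2 * N            ≡⟨ lem₂ N ⟩
    N * 4                    ∎)
    where
    lem : ∀ N c → 2 * N + c + c * 30 ≡ 2 * N + c * 31
    lem = solve-∀
    lem₂ : ∀ N → 2 * N + 2 * N ≡ N * 4
    lem₂ = solve-∀
  s = satCount (graph (c + N))
  first : s * 64 ≤ c * c * 32 + (2 * N + c + 12) * (2 * N + c + 12)
  first = begin
    s * 64                                                   ≡⟨ lem s ⟩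
    4 * s * 16                                               ≤⟨ *-monoˡ-≤ 16 (satCount-graph c N M L L≤N M≤Lc) ⟩
    (2 * (c * c) + (1 + L) * (1 + L)) * 16                   ≡⟨ lem₂ c L ⟩
    c * c * 32 + (L * 4 + 4) * (L * 4 + 4)                   ≤⟨ +-monoʳ-≤ (c * c * 32) (*-mono-≤ 4L+4≤ 4L+4≤) ⟩
    c * c * 32 + (2 * N + c + 12) * (2 * N + c + 12)         ∎
    where
    lem : ∀ s → s * 64 ≡ 4 * s * 16
    lem = solve-∀
    lem₂ : ∀ c L → (2 * (c * c) + (1 + L) * (1 + L)) * 16 ≡ c * c * 32 + (L * 4 + 4) * (L * 4 + 4)
    lem₂ = solve-∀
    4L+4≤ : L * 4 + 4 ≤ 2 * N + c + 12
    4L+4≤ = ≤-trans (+-monoˡ-≤ 4 4L≤) (≤-reflexive (+-assoc (2 * N + c) 8 4))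
  -- As 2N + c = 2n - c and 33c ≥ 2n - 32, the left side is at most 66n - (2n - 32) + 396.
  second : (2 * N + c + 12) * 33 ≤ k * 64 + 428
  second = begin
    (2 * N + c + 12) * 33                ≡⟨ lem N c ⟩
    2 * (c + N) + (N * 64 + c * 31 + 396) ≡⟨ cong (λ x → 2 * x + (N * 64 + c * 31 + 396)) c+N≡n ⟩
    2 * n + (N * 64 + c * 31 + 396)      ≤⟨ +-monoˡ-≤ _ 2n≤ ⟩
    32 + c * 33 + (N * 64 + c * 31 + 396) ≡⟨ lem₂ N c ⟩
    (c + N) * 64 + 428                   ∎
    where
    lem : ∀ N c → (2 * N + c + 12) * 33 ≡ 2 * (c + N) + (N * 64 + c * 31 + 396)
    lem = solve-∀
    lem₂ : ∀ N c → 32 + c * 33 + (N * 64 + c * 31 + 396) ≡ (c + N) * 64 + 428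
    lem₂ = solve-∀
  c33≤2k : c * 33 ≤ 2 * k
  c33≤2k = subst (λ x → c * 33 ≤ 2 * x) (sym c+N≡n) c*33≤2n
  73≤k : 73 ≤ k
  73≤k = subst (73 ≤_) (sym c+N≡n) 73≤n
  bound : 33 * s ≤ 2 * (k * k) + 33 * k
  -- 2112 = 64 · 33 lets both squares absorb a factor 33² = 1089. The constant 428² = 73 · 2509 + 27
  -- becomes linear in k because k ≥ 73.
  bound = *-cancelʳ-≤ _ _ 2112 (begin
    33 * s * 2112
      ≡⟨ lem s ⟩
    s * 64 * 1089
      ≤⟨ *-monoˡ-≤ 1089 first ⟩
    (c * c * 32 + (2 * N + c + 12) * (2 * N + c + 12)) * 1089
      ≡⟨ lem₂ c (2 * N + c + 12) ⟩
    (c * 33) * (c * 33) * 32 + ((2 * N + c + 12) * 33) * ((2 * N + c + 12) * 33)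
      ≤⟨ +-mono-≤ (*-monoˡ-≤ 32 (*-mono-≤ c33≤2k c33≤2k)) (*-mono-≤ second second) ⟩
    (2 * k) * (2 * k) * 32 + (k * 64 + 428) * (k * 64 + 428)
      ≡⟨ lem₃ k ⟩
    k * k * 4224 + k * 54784 + 73 * 2509 + 27
      ≤⟨ +-mono-≤ (+-monoʳ-≤ (k * k * 4224 + k * 54784) (*-monoˡ-≤ 2509 73≤k)) (≤-trans (m≤m+n 27 46) 73≤k) ⟩
    k * k * 4224 + k * 54784 + k * 2509 + k
      ≤⟨ m≤m+n _ (k * 12402) ⟩
    k * k * 4224 + k * 54784 + k * 2509 + k + k * 12402
      ≡⟨ lem₄ k ⟩
    (2 * (k * k) + 33 * k) * 2112 ∎)
    where
    lem : ∀ s → 33 * s * 2112 ≡ s * 64 * 1089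
    lem = solve-∀
    lem₂ : ∀ c x → (c * c * 32 + x * x) * 1089 ≡ (c * 33) * (c * 33) * 32 + (x * 33) * (x * 33)
    lem₂ = solve-∀
    lem₃ : ∀ k → (2 * k) * (2 * k) * 32 + (k * 64 + 428) * (k * 64 + 428) ≡ k * k * 4224 + k * 54784 + 183157 + 27
    lem₃ = solve-∀
    lem₄ : ∀ k → k * k * 4224 + k * 54784 + k * 2509 + k + k * 12402 ≡ (2 * (k * k) + 33 * k) * 2112
    lem₄ = solve-∀

-- Existence of the minimum

-- `LowerBound` quantifies over graphs, whose adjacency is a function. It is decided by passing to
-- Boolean matrices, over which one can quantify by induction.
Exhaustible : Set → Set₁
Exhaustible A = ∀ {P : A → Set} → (∀ a → Dec (P a)) → Dec (∀ a → P a)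

bool-exhaustible : Exhaustible Bool
bool-exhaustible P? = map′ (λ { (t , f) true → t ; (t , f) false → f }) (λ h → h true , h false) (P? true ×-dec P? false)

vec-exhaustible : ∀ {A} → Exhaustible A → ∀ n → Exhaustible (Vec A n)
vec-exhaustible A? zero    P? = map′ (λ { h [] → h }) (λ h → h []) (P? [])
vec-exhaustible A? (suc n) P? = map′ (λ { h (x ∷ xs) → h x xs }) (λ h x xs → h (x ∷ xs))
  (A? (λ x → vec-exhaustible A? n (λ xs → P? (x ∷ xs))))

Matrix : ℕ → Set
Matrix n = Vec (Vec Bool n) n

entry : ∀ {n} → Matrix n → Fin n → Fin n → Bool
entry A i j = lookup (lookup A i) j

upper : ∀ {n} → Matrix n → Fin n → Fin n → Bool
upper A i j = (toℕ i <ᵇ toℕ j) ∧ entry A i j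

-- Reading only the entries above the diagonal turns every matrix into a graph, and returns each
-- graph from its own matrix up to `≈`.
fromMatrix : ∀ {n} → Matrix n → Graph n
fromMatrix A = record
  { adj    = λ i j → upper A i j ∨ upper A j i
  ; sym    = λ i j → ∨-comm (upper A i j) (upper A j i)
  ; irrefl = λ i → cong (λ b → (b ∧ entry A i i) ∨ (b ∧ entry A i i)) (<ᵇ-false (<-irrefl {toℕ i} refl)) }

_≈_ : ∀ {n} → Graph n → Graph n → Set
G ≈ H = ∀ i j → adj G i j ≡ adj H i j

toMatrix : ∀ {n} → Graph n → Matrix n
toMatrix G = tabulate (λ i → tabulate (adj G i))

toMatrix-entry : ∀ {n} (G : Graph n) i j → entry (toMatrix G) i j ≡ adj G i j
toMatrix-entry G i j = trans (cong (λ r → lookup r j) (lookup∘tabulate (λ i → tabulate (adj G i)) i)) (lookup∘tabulate (adj G i) j)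

fromMatrix∘toMatrix : ∀ {n} (G : Graph n) → fromMatrix (toMatrix G) ≈ G
fromMatrix∘toMatrix G i j with <-cmp (toℕ i) (toℕ j)
... | tri< a _ _ rewrite <ᵇ-true a | <ᵇ-false (<⇒≯ a) = trans (∨-identityʳ _) (toMatrix-entry G i j)
... | tri> _ _ c rewrite <ᵇ-true c | <ᵇ-false (<⇒≯ c) = trans (toMatrix-entry G j i) (Graph.sym G j i)
... | tri≈ _ e _ with refl ← toℕ-injective e = trans (irrefl (fromMatrix (toMatrix G)) i) (sym (irrefl G i))

countPairs-cong : ∀ {n} {b b′ : Fin n → Fin n → Bool} → (∀ i j → b i j ≡ b′ i j) → countPairs b ≡ countPairs b′
countPairs-cong {n} {b} {b′} h = trans (countPairs≡ b) (trans
  (Σ-cong (allFin n) (λ i → Σ-cong (allFin n) (λ j → cong (λ x → before i j * ⟦ x ⟧) (h i j))))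
  (sym (countPairs≡ b′)))

saturating-cong : ∀ {n} (G H : Graph n) → G ≈ H → ∀ u v → saturating G u v ≡ saturating H u v
saturating-cong {n} G H e u v = cong₂ (λ b xs → not b ∧ or xs) (e u v)
  (map-cong (λ w → cong or (map-cong (λ x → cong₂ _∧_ (e u w) (cong₂ _∧_ (e u x) (cong₂ _∧_ (e v w) (cong₂ _∧_ (e v x) (e w x))))) (allFin n))) (allFin n))

K4Free? : ∀ {n} (G : Graph n) → Dec (K4Free G)
K4Free? G = all? λ a → all? λ b → all? λ c → all? λ d →
  T? _ →-dec (T? _ →-dec (T? _ →-dec (T? _ →-dec (T? _ →-dec (T? _ →-dec no id)))))

K4Free-≈ : ∀ {n} (G H : Graph n) → G ≈ H → K4Free H → K4Free G
K4Free-≈ G H e free a b c d ab ac ad bc bd cd = free a b c d (t ab) (t ac) (t ad) (t bc) (t bd) (t cd)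
  where t : ∀ {i j} → T (adj G i j) → T (adj H i j)
        t {i} {j} = subst T (e i j)

LowerBound? : ∀ n e ℓ → Dec (LowerBound n e ℓ)
LowerBound? n e ℓ = map′ to from (vec-exhaustible (vec-exhaustible bool-exhaustible n) n
    (λ A → K4Free? (fromMatrix A) →-dec ((edges (fromMatrix A) ℕₚ.≟ e) →-dec (ℓ ℕₚ.≤? satCount (fromMatrix A)))))
  where
  to : ((A : Matrix n) → K4Free (fromMatrix A) → edges (fromMatrix A) ≡ e → ℓ ≤ satCount (fromMatrix A)) → LowerBound n e ℓ
  to h G free eq = subst (ℓ ≤_) (countPairs-cong (saturating-cong G′ G G′≈G))
    (h (toMatrix G) (K4Free-≈ G′ G G′≈G free) (trans (countPairs-cong G′≈G) eq))
    where
    G′ = fromMatrix (toMatrix G)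
    G′≈G = fromMatrix∘toMatrix G
  from : LowerBound n e ℓ → _
  from h A = h (fromMatrix A)

last-true : ∀ {P : ℕ → Set} → (∀ ℓ → Dec (P ℓ)) → ∀ fuel ℓ → P ℓ → ¬ P (fuel + ℓ) → ∃ λ k → P k × ¬ P (suc k)
last-true P? zero       ℓ p ¬p = ⊥-elim (¬p p)
last-true {P} P? (suc fuel) ℓ p ¬p with P? (suc ℓ)
... | yes q = last-true P? fuel (suc ℓ) q (λ r → ¬p (subst P (+-suc fuel ℓ) r))
... | no ¬q = ℓ , p , ¬q

-- The two bounds for f(n, ⌊n²/4⌋ + 1).

2∑adj≡edges : ∀ {n} (G : Graph n) → ∑ (λ u → ∑ (λ v → ⟦ adj G u v ⟧)) ≡ 2 * edges G
2∑adj≡edges {n} G = begin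
  ∑ (λ u → ∑ (λ v → ⟦ adj G u v ⟧))           ≡⟨ symmetric-sum (adj G) (Graph.sym G) ⟩
  2 * edges G + ∑ (λ v → ⟦ adj G v v ⟧)       ≡⟨ cong (2 * edges G +_) (trans (Σ-cong (allFin n) (λ v → cong ⟦_⟧ (irrefl G v))) (Σ-zero (allFin n))) ⟩
  2 * edges G + 0                             ≡⟨ +-identityʳ _ ⟩
  2 * edges G                                 ∎
  where open ≡-Reasoning

-- The predicate saturating also holds on the diagonal, at the vertices of triangles; this costs
-- at most n.
many-saturating : ∀ {n} (G : Graph n) → K4Free G → edges G ≡ n * n / 4 + 1 → 2 * (n * n) ≤ 33 * satCount G + 33 * n
many-saturating {n} G free eq = *-cancelʳ-≤ _ _ 2 (begin
  2 * (n * n) * 2                              ≡⟨ lem (n * n) ⟩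
  4 * (n * n)                                  ≤⟨ sat-lower G free dense ⟩
  33 * ∑ (λ u → ∑ (λ v → ⟦ saturating G u v ⟧)) ≡⟨ cong (33 *_) (symmetric-sum (saturating G) (saturating-sym G free)) ⟩
  33 * (2 * satCount G + ∑ (λ v → ⟦ saturating G v v ⟧))
    ≤⟨ *-monoʳ-≤ 33 (+-monoʳ-≤ (2 * satCount G) (≤-trans (Σ-mono (allFin n) (λ v → ⟦⟧≤1 (saturating G v v))) (≤-reflexive (∑-1 n)))) ⟩
  33 * (2 * satCount G + n)                    ≤⟨ *-monoʳ-≤ 33 (m≤m+n (2 * satCount G + n) n) ⟩
  33 * (2 * satCount G + n + n)                ≡⟨ lem₂ (satCount G) n ⟩
  (33 * satCount G + 33 * n) * 2               ∎)
  where
  open ≤-Reasoning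
  lem : ∀ x → 2 * x * 2 ≡ 4 * x
  lem = solve-∀
  lem₂ : ∀ s n → 33 * (2 * s + n + n) ≡ (33 * s + 33 * n) * 2
  lem₂ = solve-∀
  dense : n * n < 2 * ∑ (λ u → ∑ (λ v → ⟦ adj G u v ⟧))
  dense = begin-strict
    n * n                                   ≤⟨ n²≤3+4⌊n²∕4⌋ n ⟩
    3 + 4 * (n * n / 4)                     <⟨ ≤-refl ⟩
    4 + 4 * (n * n / 4)                     ≡⟨ lem₃ (n * n / 4) ⟩
    2 * (2 * (n * n / 4 + 1))               ≡⟨ cong (λ x → 2 * (2 * x)) eq ⟨
    2 * (2 * edges G)                       ≡⟨ cong (2 *_) (2∑adj≡edges G) ⟨
    2 * ∑ (λ u → ∑ (λ v → ⟦ adj G u v ⟧))   ∎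
    where lem₃ : ∀ q → 4 + 4 * q ≡ 2 * (2 * (q + 1))
          lem₃ = solve-∀

theorem1 : ∃ λ (C : ℕ) → 0 < C × ((n : ℕ) → 73 ≤ n →
    ∃ λ (ℓ : ℕ) → IsF n (n * n / 4 + 1) ℓ ×
    (33 * ℓ ≤ 2 * (n * n) + 33 * (C * n)) ×
    (2 * (n * n) ≤ 33 * ℓ + 33 * (C * n)))
-- Each of the two bounds is off by at most n, so C = 1.
theorem1 = 1 , s≤s z≤n , λ n 73≤n → extremal n (sparse-graph n 73≤n)
  where
  open ≤-Reasoning
  extremal : ∀ n → (∃ λ (G : Graph n) → K4Free G × edges G ≡ n * n / 4 + 1 × 33 * satCount G ≤ 2 * (n * n) + 33 * n) →
    ∃ λ (ℓ : ℕ) → IsF n (n * n / 4 + 1) ℓ × (33 * ℓ ≤ 2 * (n * n) + 33 * (1 * n)) × (2 * (n * n) ≤ 33 * ℓ + 33 * (1 * n))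
  extremal n (G , free , size , sparse) = finish (last-true (LowerBound? n e) (suc (satCount G)) 0 (λ _ _ _ → z≤n) too-big)
    where
    e = n * n / 4 + 1
    too-big : ¬ LowerBound n e (suc (satCount G) + 0)
    too-big h = <-irrefl refl (subst (_≤ satCount G) (+-identityʳ (suc (satCount G))) (h G free size))
    finish : (∃ λ k → LowerBound n e k × ¬ LowerBound n e (suc k)) → _
    finish (ℓ , lower , maximal) = ℓ , (lower , maximal) , above , below
      where
      above : 33 * ℓ ≤ 2 * (n * n) + 33 * (1 * n)
      above = begin
        33 * ℓ                        ≤⟨ *-monoʳ-≤ 33 (lower G free size) ⟩
        33 * satCount G               ≤⟨ sparse ⟩
        2 * (n * n) + 33 * n          ≡⟨ cong (λ x → 2 * (n * n) + 33 * x) (*-identityˡ n) ⟨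
        2 * (n * n) + 33 * (1 * n)    ∎
      below : 2 * (n * n) ≤ 33 * ℓ + 33 * (1 * n)
      -- If the bound failed at ℓ, `many-saturating` would give every admissible graph more than ℓ
      -- saturating pairs, against the maximality of ℓ.
      below = ≮⇒≥ λ big → maximal λ H free′ size′ → *-cancelˡ-< 33 ℓ (satCount H) (+-cancelʳ-< (33 * n) _ _ (begin-strict
        33 * ℓ + 33 * n               ≡⟨ cong (λ x → 33 * ℓ + 33 * x) (*-identityˡ n) ⟨
        33 * ℓ + 33 * (1 * n)         <⟨ big ⟩
        2 * (n * n)                   ≤⟨ many-saturating H free′ size′ ⟩
        33 * satCount H + 33 * n      ∎))
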